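{- Let $m\ge1$. If $B$ and $B'$ are $m$-level rook equivalent Ferrers boards, then $r_{k,m}(B;q)=r_{k,m}(B';q)$ for every integer $k\ge0$.
   Context: Fix an integer $m\ge 1$. A Ferrers board $B=(b_1,\dots,b_n)$, with integers $0\le b_1\le\dots\le b_n$, is the set of cells $(i,j)$ with $1\le i\le n$, $1\le j\le b_i$ ($i$ is the column, counted left to right; $j$ is the row, counted bottom to top). Level $p$ ($p\ge 1$) of $B$ consists of its cells in rows $(p-1)m+1,\dots,pm$. An $m$-level rook placement of $k$ rooks on $B$ is a set of $k$ cells of $B$, no two in the same column or the same level; $r_{k,m}(B)$ is the number of these. $B,B'$ are $m$-level rook equivalent if $r_{k,m}(B)=r_{k,m}(B')$ for all $k\ge0$. For an $m$-level rook placement $\pi$ on $B$, the $m$-inversion number $\mathrm{inv}_m(\pi)$ is the number of cells $c$ of $B$ such that $c$ contains no rook, there is no rook above $c$ in the same column, and there is no rook to the left of $c$ in the same level. Define $r_{k,m}(B;q)=\sum_\pi q^{\mathrm{inv}_m(\pi)}$, the sum over all $m$-level rook placements $\pi$ of $k$ rooks on $B$. -}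

module Defs where

open import Data.Nat using (ℕ; zero; suc; _+_; _≤_; _/_; NonZero)
open import Data.Nat.Properties using () renaming (_≟_ to _≟ℕ_; _<?_ to _<ℕ?_)
open import Data.Fin using (Fin)
open import Data.Fin.Properties using () renaming (_≟_ to _≟F_; _<?_ to _<F?_)
open import Data.List using (List; []; _∷_; _++_; map; concatMap; filter; foldr; length; replicate; upTo; allFin)
open import Data.List.Relation.Unary.Any using (Any; any?)
open import Data.List.Relation.Unary.AllPairs using (AllPairs; allPairs?)
open import Data.List.Membership.Propositional using (_∉_)
import Data.List.Membership.DecPropositional as DecMembership
open import Data.Product using (_×_; _,_; proj₁; proj₂)
open import Data.Product.Properties using (≡-dec)
open import Relation.Nullary using (Dec; ¬_; ¬?; _×-dec_)
open import Relation.Binary.PropositionalEquality using (_≡_; _≢_)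
import Data.Nat as ℕ
import Data.Fin as F

record FerrersBoard : Set where
  field
    columns : ℕ
    height  : Fin columns → ℕ
    mono    : ∀ {i j} → i F.≤ j → height i ≤ height j

open FerrersBoard public

-- A cell (i , j) is (column , row), both counted from 0: it is the cell
-- (i+1 , j+1) in 1-based coordinates.
Cell : FerrersBoard → Set
Cell B = Fin (columns B) × ℕ

-- Every cell of the board, listed exactly once.
cells : (B : FerrersBoard) → List (Cell B)
cells B = concatMap (λ i → map (i ,_) (upTo (height B i))) (allFin (columns B))

-- All sublists; on a repetition-free list this enumerates each subset once.
subsets : ∀ {A : Set} → List A → List (List A)
subsets []       = [] ∷ []
subsets (x ∷ xs) = subsets xs ++ map (x ∷_) (subsets xs)

module _ (m : ℕ) .{{_ : NonZero m}} (B : FerrersBoard) where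

  -- Counted from 0: level p has the (0-based) rows p m , … , p m + m - 1.
  level : Cell B → ℕ
  level (_ , j) = j / m

  NonAttacking : Cell B → Cell B → Set
  NonAttacking c d = proj₁ c ≢ proj₁ d × level c ≢ level d

  nonAttacking? : ∀ c d → Dec (NonAttacking c d)
  nonAttacking? c d = ¬? (proj₁ c ≟F proj₁ d) ×-dec ¬? (level c ≟ℕ level d)

  IsPlacement : ℕ → List (Cell B) → Set
  IsPlacement k π = length π ≡ k × AllPairs NonAttacking π

  isPlacement? : ∀ k π → Dec (IsPlacement k π)
  isPlacement? k π = (length π ≟ℕ k) ×-dec allPairs? nonAttacking? π

  placements : ℕ → List (List (Cell B))
  placements k = filter (isPlacement? k) (subsets (cells B))

  rookNumber : ℕ → ℕ
  rookNumber k = length (placements k)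

  AboveInColumn : Cell B → Cell B → Set
  AboveInColumn c r = proj₁ r ≡ proj₁ c × proj₂ c ℕ.< proj₂ r

  LeftInLevel : Cell B → Cell B → Set
  LeftInLevel c r = level r ≡ level c × proj₁ r F.< proj₁ c

  Inversion : List (Cell B) → Cell B → Set
  Inversion π c = c ∉ π × ¬ Any (AboveInColumn c) π × ¬ Any (LeftInLevel c) π

  inversion? : ∀ π c → Dec (Inversion π c)
  inversion? π c =
    ¬? (c ∈? π)
      ×-dec ¬? (any? (λ r → (proj₁ r ≟F proj₁ c) ×-dec (proj₂ c <ℕ? proj₂ r)) π)
      ×-dec ¬? (any? (λ r → (level r ≟ℕ level c) ×-dec (proj₁ r <F? proj₁ c)) π)
    where open DecMembership (≡-dec (_≟F_ {columns B}) _≟ℕ_) using (_∈?_)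

  inv : List (Cell B) → ℕ
  inv π = length (filter (inversion? π) (cells B))

-- Polynomials in q over ℕ as coefficient lists, constant term first.
-- Trailing zeros are allowed, so equality of polynomials is _≈_, not _≡_.
Poly : Set
Poly = List ℕ

coeff : Poly → ℕ → ℕ
coeff []       _       = 0
coeff (a ∷ _)  zero    = a
coeff (_ ∷ as) (suc d) = coeff as d

infix 4 _≈_
_≈_ : Poly → Poly → Set
f ≈ g = ∀ d → coeff f d ≡ coeff g d

infixl 6 _⊕_
_⊕_ : Poly → Poly → Poly
[]       ⊕ g        = g
(a ∷ as) ⊕ []       = a ∷ as
(a ∷ as) ⊕ (b ∷ bs) = (a + b) ∷ (as ⊕ bs)

q^_ : ℕ → Poly
q^ d = replicate d 0 ++ (1 ∷ [])

qRookNumber : (m : ℕ) .{{_ : NonZero m}} → FerrersBoard → ℕ → Poly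
qRookNumber m B k = foldr (λ π f → (q^ inv m B π) ⊕ f) [] (placements m B k)

RookEquivalent : (m : ℕ) .{{_ : NonZero m}} → FerrersBoard → FerrersBoard → Set
RookEquivalent m B B′ = ∀ k → rookNumber m B k ≡ rookNumber m B′ k

{-# OPTIONS --safe #-}

-- Place the rooks level by level from the top. A rook above level p sits in a
-- column that fills all m rows of level p, so k rooks above level p leave exactly
-- N = a_p − k m of its a_p cells available. Leaving level p empty contributes q^N,
-- and the placements of one rook in it contribute [N]_q = 1 + q + ⋯ + q^(N−1). With
-- c_p = a_p − (number of levels above p) m and s the number of empty levels so far,
-- this is an operator T_c, (T_c g)(s) = q^(c+(s−1)m) g(s−1) + [c+sm]_q g(s), and
-- the operators T_c commute: the q-rook numbers depend only on the multiset of
-- the c_p. At q = 1 the operator T_c is multiplication by x + c in the basis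
-- x(x−m)⋯(x−(s−1)m), so the rook numbers determine ∏ (x + c_p), hence the multiset.
-- The q-identity is checked at all integers q ≥ 2, which determines the coefficients.
module Submission where

open import Defs
open import Data.Bool using (if_then_else_; true; false)
open import Data.Fin using (Fin)
import Data.Fin as F
import Data.Fin.Properties as F
open import Data.List using (List; []; _∷_; length; _++_; map; filter; concatMap; allFin; upTo; downFrom; foldr)
open import Data.List.Membership.Propositional using (_∈_)
open import Data.List.Membership.Propositional.Properties
open import Data.List.Membership.Propositional.Properties.WithK using (unique∧set⇒bag)
open import Data.List.Properties using (map-++; map-∘; filter-all; filter-none; filter-++; length-++; length-map; length-upTo; ++-identityʳ)
open import Data.List.Relation.Binary.BagAndSetEquality using (∼bag⇒↭)
open import Data.List.Relation.Binary.Permutation.Propositional using (_↭_; refl; prep; swap; trans; ↭-refl; ↭-sym; ↭⇒↭ₛ)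
open import Data.List.Relation.Binary.Permutation.Propositional.Properties using (shift; ↭-length; filter-↭; All-resp-↭)
import Data.List.Relation.Binary.Permutation.Setoid.Properties as Permutationₛ
open import Data.List.Relation.Unary.All as All using (All; []; _∷_)
import Data.List.Relation.Unary.All.Properties as All
open import Data.List.Relation.Unary.AllPairs as AllPairs using (AllPairs; []; _∷_; allPairs?)
import Data.List.Relation.Unary.AllPairs.Properties as AllPairs
open import Data.List.Relation.Unary.Any as Any using (here; there)
open import Data.List.Relation.Unary.Unique.Propositional using (Unique)
import Data.List.Relation.Unary.Unique.Propositional.Properties as Unique
open import Data.Nat as ℕ using (ℕ; zero; suc; z≤n; s≤s; NonZero)
import Data.Nat.Properties as ℕ
import Data.Nat.Tactic.RingSolver as ℕSolver
open import Data.Product using (_×_; _,_; ∃; proj₁; proj₂)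
open import Data.Sum using (_⊎_; inj₁; inj₂; [_,_]′)
open import Data.Unit using (tt)
open import Function using (_∘_; case_of_; _⇔_; mk⇔; Equivalence)
open import Function.Properties.Equivalence using () renaming (trans to ⇔-trans; sym to ⇔-sym)
open import Level using (0ℓ)
open import Relation.Binary using (Rel; Irreflexive; Asymmetric; tri<; tri≈; tri>)
import Relation.Binary as B
open import Relation.Binary.PropositionalEquality as ≡ using (_≡_; _≢_; ≢-sym; refl; cong; cong₂; sym; module ≡-Reasoning)
open import Relation.Nullary using (Dec; yes; no; does; ¬_; ¬?; _×-dec_; _⊎-dec_; contradiction)
open import Relation.Nullary.Decidable using (dec-true; dec-false; does-⇔; toSum)
open import Relation.Unary using (Pred; Decidable)

-- Counting by the number k of rooks hides the symmetry: the coefficients involve a_p - k m, which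
-- mixes the size of level p with its position. If s of the levels above p are empty, then k is the
-- number of those levels minus s, so a_p - k m = c_p + s m and the position enters only through
-- c_p. This is why the operators act on sequences indexed by s.
--
-- The price is that c_p may be negative. In the board's own order a negative a_p - k m only meets a
-- zero term, because k rooks above level p need k m cells in it; but commutation has to hold for
-- all coefficients. Hence, for q ≥ 2, the shift of every exponent by L m and a factor (q - 1) q^(L
-- m) per level, with the computation carried out in ℤ.
--
-- Both boards are given the same L, padded with empty levels, so that the two multisets have equal
-- size and the two products of linear factors equal degree.

module LevelOperators where

  -- Level operators with abstract coefficients

  open import Data.Integer using (ℤ; +_; _+_; _*_; _-_; -_; 0ℤ; 1ℤ; _^_; ≢-nonZero)
  import Data.Integer as ℤ
  import Data.Integer.Properties as ℤ
  open import Data.Integer.Tactic.RingSolver using (solve-∀)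

  -- `α` weighs an empty level and `Φ` a level with a rook. They stay abstract so that the same
  -- operators serve both q = 1 and, after scaling, q ≥ 2.
  module Transfer (m : ℕ) (α Φ : ℕ → ℤ) where

    -- Recursive, so that `pos C (suc s)` unfolds to `m + pos C s`, the form in which `α-sym` and
    -- `αΦ-sym` apply.
    pos : ℕ → ℕ → ℕ
    pos C zero    = C
    pos C (suc s) = m ℕ.+ pos C s

    pos-* : ∀ C s → pos C s ≡ s ℕ.* m ℕ.+ C
    pos-* C zero    = refl
    pos-* C (suc s) = ≡.trans (cong (m ℕ.+_) (pos-* C s)) (sym (ℕ.+-assoc m (s ℕ.* m) C))

    -- s counts the levels left without a rook; C encodes the size of the level
    -- added below (see levelShifts).
    step : ℕ → (ℕ → ℤ) → ℕ → ℤ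
    step C g zero    = Φ C * g zero
    step C g (suc s) = α (pos C s) * g s + Φ (pos C (suc s)) * g (suc s)

    transfer : List ℕ → ℕ → ℤ
    transfer []       zero    = 1ℤ
    transfer []       (suc s) = 0ℤ
    transfer (C ∷ Cs) s       = step C (transfer Cs) s

    step-cong : ∀ C {g h} → (∀ s → g s ≡ h s) → ∀ s → step C g s ≡ step C h s
    step-cong C eq zero    = cong (Φ C *_) (eq zero)
    step-cong C eq (suc s) = cong₂ (λ u v → α (pos C s) * u + Φ (pos C (suc s)) * v) (eq s) (eq (suc s))

    transfer-vanishes : ∀ Cs s → length Cs ℕ.< s → transfer Cs s ≡ 0ℤ
    transfer-vanishes []       (suc s) _ = refl
    transfer-vanishes (C ∷ Cs) (suc s) (s≤s l<s)
      rewrite transfer-vanishes Cs s l<s | transfer-vanishes Cs (suc s) (ℕ.m≤n⇒m≤1+n l<s)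
            | ℤ.*-zeroʳ (α (pos C s)) | ℤ.*-zeroʳ (Φ (pos C (suc s))) = refl

    module _
      (α-sym : ∀ a b → α (m ℕ.+ b) * α a ≡ α (m ℕ.+ a) * α b)
      (αΦ-sym : ∀ a b → α b * Φ a + Φ (m ℕ.+ b) * α a ≡ α a * Φ b + Φ (m ℕ.+ a) * α b)
      where

      -- The entry at index s of a double step involves `g` at s, s - 1 and s - 2. The coefficient
      -- at s is a product of two values of `Φ`, symmetric outright; `αΦ-sym` settles the one at s -
      -- 1 and `α-sym` the one at s - 2.
      step-comm : ∀ C D g s → step D (step C g) s ≡ step C (step D g) s
      step-comm C D g zero = lemma (Φ C) (Φ D) (g 0)
        where
        lemma : ∀ x y z → y * (x * z) ≡ x * (y * z)
        lemma = solve-∀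
      step-comm C D g (suc zero) = begin
        α D * (Φ C * g 0) + Φ (m ℕ.+ D) * (α C * g 0 + Φ (m ℕ.+ C) * g 1)
          ≡⟨ lemma (α D) (Φ C) (Φ (m ℕ.+ D)) (α C) (Φ (m ℕ.+ C)) (g 0) (g 1) ⟩
        (α D * Φ C + Φ (m ℕ.+ D) * α C) * g 0 + Φ (m ℕ.+ C) * Φ (m ℕ.+ D) * g 1
          ≡⟨ cong₂ (λ u v → u * g 0 + v * g 1) (αΦ-sym C D) (ℤ.*-comm (Φ (m ℕ.+ C)) (Φ (m ℕ.+ D))) ⟩
        (α C * Φ D + Φ (m ℕ.+ C) * α D) * g 0 + Φ (m ℕ.+ D) * Φ (m ℕ.+ C) * g 1
          ≡⟨ lemma (α C) (Φ D) (Φ (m ℕ.+ C)) (α D) (Φ (m ℕ.+ D)) (g 0) (g 1) ⟨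
        α C * (Φ D * g 0) + Φ (m ℕ.+ C) * (α D * g 0 + Φ (m ℕ.+ D) * g 1) ∎
        where
        open ≡-Reasoning
        lemma : ∀ aD fC fD′ aC fC′ g₀ g₁ →
                aD * (fC * g₀) + fD′ * (aC * g₀ + fC′ * g₁) ≡ (aD * fC + fD′ * aC) * g₀ + fC′ * fD′ * g₁
        lemma = solve-∀
      step-comm C D g (suc (suc s)) = begin
        α b′ * (α a * g s + Φ a′ * g (suc s)) + Φ (m ℕ.+ b′) * (α a′ * g (suc s) + Φ (m ℕ.+ a′) * g (suc (suc s)))
          ≡⟨ lemma (α b′) (α a) (Φ a′) (Φ (m ℕ.+ b′)) (α a′) (Φ (m ℕ.+ a′)) _ _ _ ⟩
        α b′ * α a * g s + (α b′ * Φ a′ + Φ (m ℕ.+ b′) * α a′) * g (suc s) + Φ (m ℕ.+ a′) * Φ (m ℕ.+ b′) * g (suc (suc s))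
          ≡⟨ cong₂ _+_ (cong₂ (λ u v → u * g s + v * g (suc s)) (α-sym a b) (αΦ-sym a′ b′))
                       (cong (_* g (suc (suc s))) (ℤ.*-comm (Φ (m ℕ.+ a′)) (Φ (m ℕ.+ b′)))) ⟩
        α a′ * α b * g s + (α a′ * Φ b′ + Φ (m ℕ.+ a′) * α b′) * g (suc s) + Φ (m ℕ.+ b′) * Φ (m ℕ.+ a′) * g (suc (suc s))
          ≡⟨ lemma (α a′) (α b) (Φ b′) (Φ (m ℕ.+ a′)) (α b′) (Φ (m ℕ.+ b′)) _ _ _ ⟨
        α a′ * (α b * g s + Φ b′ * g (suc s)) + Φ (m ℕ.+ a′) * (α b′ * g (suc s) + Φ (m ℕ.+ b′) * g (suc (suc s))) ∎
        where
        open ≡-Reasoning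
        a b a′ b′ : ℕ
        a = pos C s
        b = pos D s
        a′ = m ℕ.+ a
        b′ = m ℕ.+ b
        lemma : ∀ x₁ x₂ x₃ x₄ x₅ x₆ g₀ g₁ g₂ →
                x₁ * (x₂ * g₀ + x₃ * g₁) + x₄ * (x₅ * g₁ + x₆ * g₂)
                  ≡ x₁ * x₂ * g₀ + (x₁ * x₃ + x₄ * x₅) * g₁ + x₆ * x₄ * g₂
        lemma = solve-∀

      transfer-↭ : ∀ {Cs Ds} → Cs ↭ Ds → ∀ s → transfer Cs s ≡ transfer Ds s
      transfer-↭ refl         s = refl
      transfer-↭ (prep C p)   s = step-cong C (transfer-↭ p) s
      transfer-↭ {C ∷ D ∷ Cs} (swap .C .D p) s = ≡.trans (step-comm D C (transfer Cs) s)
        (step-cong D (step-cong C (transfer-↭ p)) s)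
      transfer-↭ (trans p p′) s = ≡.trans (transfer-↭ p s) (transfer-↭ p′ s)

  -- The case q = 1: products of linear factors

  module _ (m K : ℕ) where

    private
      -- `K` is later the shift `L * m` built into `levelShifts`; subtracting it recovers the true,
      -- possibly negative, integer.
      α Φ : ℕ → ℤ
      α _ = 1ℤ
      Φ n = + n - + K

    open Transfer m α Φ

    linear-α-sym : ∀ a b → α (m ℕ.+ b) * α a ≡ α (m ℕ.+ a) * α b
    linear-α-sym a b = refl

    linear-αΦ-sym : ∀ a b → α b * Φ a + Φ (m ℕ.+ b) * α a ≡ α a * Φ b + Φ (m ℕ.+ a) * α b
    linear-αΦ-sym a b = lemma (+ a) (+ b) (+ m) (+ K)
      where
      lemma : ∀ x y u k → 1ℤ * (x - k) + (u + y - k) * 1ℤ ≡ 1ℤ * (y - k) + (u + x - k) * 1ℤ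
      lemma = solve-∀

    -- In the basis x(x − m)⋯(x − (s−1)m), step C is multiplication by x + C − K.
    basis : ℤ → ℕ → ℤ
    basis x zero    = 1ℤ
    basis x (suc s) = (x - + (s ℕ.* m)) * basis x s

    expansion : ℤ → (ℕ → ℤ) → ℕ → ℤ
    expansion x g zero    = 0ℤ
    expansion x g (suc n) = expansion x g n + g n * basis x n

    expansion-cong : ∀ x {g h} → (∀ s → g s ≡ h s) → ∀ n → expansion x g n ≡ expansion x h n
    expansion-cong x eq zero    = refl
    expansion-cong x eq (suc n) = cong₂ (λ u v → u + v * basis x n) (expansion-cong x eq n) (eq n)

    Φ-pos : ∀ C s → Φ (pos C s) ≡ + (s ℕ.* m) + (+ C - + K)
    Φ-pos C s = ≡.trans (cong (λ n → + n - + K) (pos-* C s)) (ℤ.+-assoc (+ (s ℕ.* m)) (+ C) (- (+ K)))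

    -- Since `basis x (suc s)` is (x - s m) times `basis x s`, the two contributions of `g s` add up
    -- to (x + C - K) `g s * basis x s`. The truncation cuts off one of the two for s = n, which
    -- leaves the last term; it disappears when `g n` is zero.
    expansion-step : ∀ x C g n →
      expansion x (step C g) (suc n)
        ≡ (x + (+ C - + K)) * expansion x g n + Φ (pos C n) * g n * basis x n
    expansion-step x C g zero = lemma (x + (+ C - + K)) (Φ C) (g 0)
      where
      lemma : ∀ y u v → 0ℤ + u * v * 1ℤ ≡ y * 0ℤ + u * v * 1ℤ
      lemma = solve-∀
    expansion-step x C g (suc n) = begin
      expansion x (step C g) (suc n) + (1ℤ * g n + Φ (pos C (suc n)) * g (suc n)) * basis x (suc n)
        ≡⟨ cong (_+ (1ℤ * g n + Φ (pos C (suc n)) * g (suc n)) * basis x (suc n)) (expansion-step x C g n) ⟩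
      (x + (+ C - + K)) * expansion x g n + Φ (pos C n) * g n * basis x n
        + (1ℤ * g n + Φ (pos C (suc n)) * g (suc n)) * basis x (suc n)
        ≡⟨ cong (λ u → (x + (+ C - + K)) * expansion x g n + u * g n * basis x n
             + (1ℤ * g n + Φ (pos C (suc n)) * g (suc n)) * basis x (suc n)) (Φ-pos C n) ⟩
      (x + (+ C - + K)) * expansion x g n + (+ (n ℕ.* m) + (+ C - + K)) * g n * basis x n
        + (1ℤ * g n + Φ (pos C (suc n)) * g (suc n)) * ((x - + (n ℕ.* m)) * basis x n)
        ≡⟨ lemma x (+ C - + K) (expansion x g n) (+ (n ℕ.* m)) (g n) (basis x n) (Φ (pos C (suc n))) (g (suc n)) ⟩
      (x + (+ C - + K)) * (expansion x g n + g n * basis x n)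
        + Φ (pos C (suc n)) * g (suc n) * ((x - + (n ℕ.* m)) * basis x n) ∎
      where
      open ≡-Reasoning
      lemma : ∀ x c e n g b f g′ →
        (x + c) * e + (n + c) * g * b + (1ℤ * g + f * g′) * ((x - n) * b)
          ≡ (x + c) * (e + g * b) + f * g′ * ((x - n) * b)
      lemma = solve-∀

    roots : ℤ → List ℕ → ℤ
    roots x []       = 1ℤ
    roots x (C ∷ Cs) = (x + (+ C - + K)) * roots x Cs

    expansion-transfer : ∀ x Cs → expansion x (transfer Cs) (suc (length Cs)) ≡ roots x Cs
    expansion-transfer x []       = refl
    expansion-transfer x (C ∷ Cs) = begin
      expansion x (step C (transfer Cs)) (suc (suc (length Cs)))
        ≡⟨ expansion-step x C (transfer Cs) (suc (length Cs)) ⟩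
      (x + (+ C - + K)) * expansion x (transfer Cs) (suc (length Cs))
        + Φ (pos C (suc (length Cs))) * transfer Cs (suc (length Cs)) * basis x (suc (length Cs))
        ≡⟨ cong₂ (λ u v → (x + (+ C - + K)) * u + Φ (pos C (suc (length Cs))) * v * basis x (suc (length Cs)))
             (expansion-transfer x Cs) (transfer-vanishes Cs (suc (length Cs)) ℕ.≤-refl) ⟩
      (x + (+ C - + K)) * roots x Cs + Φ (pos C (suc (length Cs))) * 0ℤ * basis x (suc (length Cs))
        ≡⟨ lemma ((x + (+ C - + K)) * roots x Cs) (Φ (pos C (suc (length Cs)))) (basis x (suc (length Cs))) ⟩
      (x + (+ C - + K)) * roots x Cs ∎
      where
      open ≡-Reasoning
      lemma : ∀ u v w → u + v * 0ℤ * w ≡ u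
      lemma = solve-∀

    root⇒∈ : ∀ C Ds → roots (+ K - + C) Ds ≡ 0ℤ → C ∈ Ds
    root⇒∈ C (D ∷ Ds) eq with ℤ.i*j≡0⇒i≡0∨j≡0 (+ K - + C + (+ D - + K)) eq
    ... | inj₂ eq′ = there (root⇒∈ C Ds eq′)
    ... | inj₁ eq′ = here (ℤ.+-injective (sym (ℤ.i-j≡0⇒i≡j (+ D) (+ C) (≡.trans (lemma (+ K) (+ C) (+ D)) eq′))))
      where
      lemma : ∀ k c d → d - c ≡ k - c + (d - k)
      lemma = solve-∀

    -- The coefficient of `g s` in `step C g (suc s)` is 1, so `g s` is determined by the step and
    -- by `g (suc s)`. Descending from a range where both sequences agree reaches every index.
    step-injective : ∀ C {g h} n → (∀ s → n ℕ.≤ s → g s ≡ h s) →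
                     (∀ s → step C g s ≡ step C h s) → ∀ s → g s ≡ h s
    step-injective C {g} {h} n tail eq s = go n s (ℕ.m≤m+n n s)
      where
      -- `j` bounds how far `s` lies below `n`.
      go : ∀ j s → n ℕ.≤ j ℕ.+ s → g s ≡ h s
      go zero    s n≤s = tail s n≤s
      go (suc j) s n≤  = begin
        g s ≡⟨ lemma (g s) (Φ (pos C (suc s))) (g (suc s)) ⟩
        step C g (suc s) - Φ (pos C (suc s)) * g (suc s)
          ≡⟨ cong₂ (λ u v → u - Φ (pos C (suc s)) * v) (eq (suc s))
               (go j (suc s) (ℕ.≤-trans n≤ (ℕ.≤-reflexive (sym (ℕ.+-suc j s))))) ⟩
        step C h (suc s) - Φ (pos C (suc s)) * h (suc s)
          ≡⟨ lemma (h s) (Φ (pos C (suc s))) (h (suc s)) ⟨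
        h s ∎
        where
        open ≡-Reasoning
        lemma : ∀ x f y → x ≡ 1ℤ * x + f * y - f * y
        lemma = solve-∀

    -- At x = K - C the factor of the head vanishes, hence so does the other product. Equal lengths
    -- make both expansions stop at the same index.
    head∈ : ∀ C Cs Ds → length (C ∷ Cs) ≡ length Ds →
            (∀ s → transfer (C ∷ Cs) s ≡ transfer Ds s) → C ∈ Ds
    head∈ C Cs Ds len eq = root⇒∈ C Ds (begin
      roots x Ds                                              ≡⟨ expansion-transfer x Ds ⟨
      expansion x (transfer Ds) (suc (length Ds))             ≡⟨ expansion-cong x {transfer (C ∷ Cs)} {transfer Ds} eq (suc (length Ds)) ⟨
      expansion x (transfer (C ∷ Cs)) (suc (length Ds))       ≡⟨ cong (λ n → expansion x (transfer (C ∷ Cs)) (suc n)) len ⟨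
      expansion x (transfer (C ∷ Cs)) (suc (suc (length Cs))) ≡⟨ expansion-transfer x (C ∷ Cs) ⟩
      (x + (+ C - + K)) * roots x Cs                          ≡⟨ lemma (+ K) (+ C) (roots x Cs) ⟩
      0ℤ                                                      ∎)
      where
      open ≡-Reasoning
      x : ℤ
      x = + K - + C
      lemma : ∀ k c r → (k - c + (c - k)) * r ≡ 0ℤ
      lemma = solve-∀

    transfer-cancel : ∀ C Cs Ds → length Cs ≡ length Ds →
      (∀ s → transfer (C ∷ Cs) s ≡ transfer (C ∷ Ds) s) → ∀ s → transfer Cs s ≡ transfer Ds s
    transfer-cancel C Cs Ds len = step-injective C {transfer Cs} {transfer Ds} (suc (length Cs)) tail
      where
      tail : ∀ s → length Cs ℕ.< s → transfer Cs s ≡ transfer Ds s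
      tail s l<s = ≡.trans (transfer-vanishes Cs s l<s)
        (sym (transfer-vanishes Ds s (≡.subst (ℕ._< s) len l<s)))

    -- Unique factorisation into linear factors: the head is found in the other list as a root,
    -- commutation brings it to the front, and injectivity of its step cancels it.
    transfer-injective : ∀ Cs Ds → length Cs ≡ length Ds →
      (∀ s → transfer Cs s ≡ transfer Ds s) → Cs ↭ Ds
    transfer-injective []       []  _ _ = ↭-refl
    transfer-injective (C ∷ Cs) Ds len eq = remove (∈-∃++ (head∈ C Cs Ds len eq))
      where
      remove : (∃ λ Ds₁ → ∃ λ Ds₂ → Ds ≡ Ds₁ ++ C ∷ Ds₂) → C ∷ Cs ↭ Ds
      remove (Ds₁ , Ds₂ , Ds≡) = trans (prep C (transfer-injective Cs (Ds₁ ++ Ds₂) len′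
          (transfer-cancel C Cs (Ds₁ ++ Ds₂) len′ eq′))) (↭-sym Ds↭)
        where
        Ds↭ : Ds ↭ C ∷ Ds₁ ++ Ds₂
        Ds↭ = ≡.subst (_↭ C ∷ Ds₁ ++ Ds₂) (sym Ds≡) (shift C Ds₁ Ds₂)
        len′ : length Cs ≡ length (Ds₁ ++ Ds₂)
        len′ = ℕ.suc-injective (≡.trans len (↭-length Ds↭))
        eq′ : ∀ s → transfer (C ∷ Cs) s ≡ transfer (C ∷ Ds₁ ++ Ds₂) s
        eq′ s = ≡.trans (eq s) (transfer-↭ linear-α-sym linear-αΦ-sym Ds↭ s)

  -- The recurrence over levels and its solution by the operators

  -- c_p + L m, where L is the total number of levels; the shift by L m keeps it in ℕ.
  levelShifts : ℕ → (ℕ → ℕ) → ℕ → ℕ → List ℕ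
  levelShifts m a p zero    = []
  levelShifts m a p (suc t) = (suc p ℕ.* m ℕ.+ a p) ∷ levelShifts m a (suc p) t

  length-levelShifts : ∀ m a p t → length (levelShifts m a p t) ≡ t
  length-levelShifts m a p zero    = refl
  length-levelShifts m a p (suc t) = cong suc (length-levelShifts m a (suc p) t)

  -- F p k counts the placements of k rooks in the levels ≥ p, and a p the cells of level p.
  record Recurrence (m L : ℕ) (a : ℕ → ℕ) (e br : ℕ → ℕ) (F : ℕ → ℕ → ℕ) : Set where
    field
      top-zero : F L 0 ≡ 1
      top-suc  : ∀ k → F L (suc k) ≡ 0
      rec-zero : ∀ p → F p 0 ≡ F (suc p) 0 ℕ.* e (a p)
      rec-suc  : ∀ p k → F p (suc k) ≡ F (suc p) (suc k) ℕ.* e (a p ℕ.∸ suc k ℕ.* m)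
                                        ℕ.+ F (suc p) k ℕ.* br (a p ℕ.∸ k ℕ.* m)
      vanish   : ∀ p k → a p ℕ.< k ℕ.* m → F (suc p) k ≡ 0

    too-many : ∀ p t k → p ℕ.+ t ≡ L → t ℕ.< k → F p k ≡ 0
    too-many p zero (suc k) eq _ =
      ≡.subst (λ l → F l (suc k) ≡ 0) (≡.trans (sym eq) (ℕ.+-identityʳ p)) (top-suc k)
    too-many p (suc t) (suc k) eq (s≤s t<k)
      rewrite rec-suc p k
            | too-many (suc p) t (suc k) (≡.trans (sym (ℕ.+-suc p t)) eq) (ℕ.m≤n⇒m≤1+n t<k)
            | too-many (suc p) t k (≡.trans (sym (ℕ.+-suc p t)) eq) t<k = refl

  -- The scaling κ clears the denominators of q^c and [c] = (q^c − 1)/(q − 1),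
  -- where c may be negative.
  module Solution {m L a e br F} (rec : Recurrence m L a e br F)
    (κ : ℤ) (α Φ : ℕ → ℤ)
    (κe : ∀ N → κ * + e N ≡ α (N ℕ.+ L ℕ.* m))
    (κbr : ∀ N → κ * + br N ≡ Φ (N ℕ.+ L ℕ.* m))
    where

    open Recurrence rec
    open Transfer m α Φ

    private
      C : ℕ → ℕ
      C p = suc p ℕ.* m ℕ.+ a p

      -- There are k + s levels above p, so L m contains a summand k m that cancels against the one
      -- subtracted from `a p`. What is left depends on p through `C p` alone.
      excess : ∀ p k s → p ℕ.+ suc (k ℕ.+ s) ≡ L → k ℕ.* m ℕ.≤ a p →
               (a p ℕ.∸ k ℕ.* m) ℕ.+ L ℕ.* m ≡ pos (C p) s
      excess p k s refl km≤a = begin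
        N ℕ.+ (p ℕ.+ suc (k ℕ.+ s)) ℕ.* m         ≡⟨ lemma N p k s m ⟩
        s ℕ.* m ℕ.+ (suc p ℕ.* m ℕ.+ (N ℕ.+ k ℕ.* m)) ≡⟨ cong (λ x → s ℕ.* m ℕ.+ (suc p ℕ.* m ℕ.+ x)) (ℕ.m∸n+n≡m km≤a) ⟩
        s ℕ.* m ℕ.+ C p                           ≡⟨ pos-* (C p) s ⟨
        pos (C p) s                               ∎
        where
        open ≡-Reasoning
        N : ℕ
        N = a p ℕ.∸ k ℕ.* m
        lemma : ∀ N p k s m → N ℕ.+ (p ℕ.+ suc (k ℕ.+ s)) ℕ.* m
                                ≡ s ℕ.* m ℕ.+ (suc p ℕ.* m ℕ.+ (N ℕ.+ k ℕ.* m))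
        lemma = ℕSolver.solve-∀

      rescale : ∀ (f : ℕ → ℕ) (ψ : ℕ → ℤ) → (∀ N → κ * + f N ≡ ψ (N ℕ.+ L ℕ.* m)) →
                ∀ p k s → p ℕ.+ suc (k ℕ.+ s) ≡ L → ∀ z →
                κ * z * + (F (suc p) k ℕ.* f (a p ℕ.∸ k ℕ.* m)) ≡ ψ (pos (C p) s) * (z * + F (suc p) k)
      rescale f ψ κf p k s eq z with k ℕ.* m ℕ.≤? a p
      -- Here `∸` truncates and the coefficient is not the one of the operator, but its factor
      -- `F (suc p) k` is zero.
      ... | no ≰ rewrite vanish p k (ℕ.≰⇒> ≰) | ℤ.*-zeroʳ z | ℤ.*-zeroʳ (ψ (pos (C p) s)) = ℤ.*-zeroʳ (κ * z)
      ... | yes km≤a = begin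
        κ * z * + (F (suc p) k ℕ.* f N)   ≡⟨ cong (κ * z *_) (ℤ.pos-* (F (suc p) k) (f N)) ⟩
        κ * z * (+ F (suc p) k * + f N)   ≡⟨ lemma κ z (+ F (suc p) k) (+ f N) ⟩
        κ * + f N * (z * + F (suc p) k)   ≡⟨ cong (_* (z * + F (suc p) k)) (≡.trans (κf N) (cong ψ (excess p k s eq km≤a))) ⟩
        ψ (pos (C p) s) * (z * + F (suc p) k) ∎
        where
        open ≡-Reasoning
        N : ℕ
        N = a p ℕ.∸ k ℕ.* m
        lemma : ∀ u z x y → u * z * (x * y) ≡ u * y * (z * x)
        lemma = solve-∀

    -- Each of the t levels uses one factor `κ`. The two border cases drop one term of the
    -- recursion: for k = 0, the operator's `Φ` term would need more empty levels than there are
    -- levels; for s = 0, the term for an empty level p would need more rooks than there are levels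
    -- above it.
    scaled≡transfer : ∀ t p k s → p ℕ.+ t ≡ L → k ℕ.+ s ≡ t →
                      κ ^ t * + F p k ≡ transfer (levelShifts m a p t) s
    scaled≡transfer zero p zero zero eq refl =
      ≡.subst (λ l → 1ℤ * + F l 0 ≡ 1ℤ) (≡.trans (sym eq) (ℕ.+-identityʳ p)) (cong (λ x → 1ℤ * + x) top-zero)
    scaled≡transfer (suc t) p zero (suc .t) eq refl = begin
      κ * κ ^ t * + F p 0                          ≡⟨ cong (λ x → κ * κ ^ t * + x) (rec-zero p) ⟩
      κ * κ ^ t * + (F (suc p) 0 ℕ.* e (a p))      ≡⟨ rescale e α κe p 0 t eq (κ ^ t) ⟩
      α (pos (C p) t) * (κ ^ t * + F (suc p) 0)
        ≡⟨ cong (α (pos (C p) t) *_) (scaled≡transfer t (suc p) 0 t eq′ refl) ⟩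
      α (pos (C p) t) * transfer Cs t              ≡⟨ lemma _ (Φ (pos (C p) (suc t))) ⟩
      α (pos (C p) t) * transfer Cs t + Φ (pos (C p) (suc t)) * 0ℤ
        ≡⟨ cong (λ x → α (pos (C p) t) * transfer Cs t + Φ (pos (C p) (suc t)) * x)
             (transfer-vanishes Cs (suc t) (s≤s (ℕ.≤-reflexive (length-levelShifts m a (suc p) t)))) ⟨
      α (pos (C p) t) * transfer Cs t + Φ (pos (C p) (suc t)) * transfer Cs (suc t) ∎
      where
      open ≡-Reasoning
      Cs : List ℕ
      Cs = levelShifts m a (suc p) t
      eq′ : suc p ℕ.+ t ≡ L
      eq′ = ≡.trans (sym (ℕ.+-suc p t)) eq
      lemma : ∀ x y → x ≡ x + y * 0ℤ
      lemma = solve-∀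
    scaled≡transfer (suc .(k ℕ.+ zero)) p (suc k) zero eq refl = begin
      κ * κ ^ t * + F p (suc k)                    ≡⟨ cong (λ x → κ * κ ^ t * + x) (rec-suc p k) ⟩
      κ * κ ^ t * + (F (suc p) (suc k) ℕ.* e (a p ℕ.∸ suc k ℕ.* m) ℕ.+ F (suc p) k ℕ.* br (a p ℕ.∸ k ℕ.* m))
        ≡⟨ cong (λ x → κ * κ ^ t * + (x ℕ.* e (a p ℕ.∸ suc k ℕ.* m) ℕ.+ F (suc p) k ℕ.* br (a p ℕ.∸ k ℕ.* m)))
             (too-many (suc p) t (suc k) eq′ (s≤s (ℕ.≤-reflexive (ℕ.+-identityʳ k)))) ⟩
      κ * κ ^ t * + (F (suc p) k ℕ.* br (a p ℕ.∸ k ℕ.* m))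
        ≡⟨ rescale br Φ κbr p k 0 eq (κ ^ t) ⟩
      Φ (C p) * (κ ^ t * + F (suc p) k)
        ≡⟨ cong (Φ (C p) *_) (scaled≡transfer t (suc p) k 0 eq′ refl) ⟩
      Φ (C p) * transfer (levelShifts m a (suc p) t) 0 ∎
      where
      open ≡-Reasoning
      t : ℕ
      t = k ℕ.+ 0
      eq′ : suc p ℕ.+ t ≡ L
      eq′ = ≡.trans (sym (ℕ.+-suc p t)) eq
    scaled≡transfer (suc .(k ℕ.+ suc s)) p (suc k) (suc s) eq refl = begin
      κ * κ ^ t * + F p (suc k)                    ≡⟨ cong (λ x → κ * κ ^ t * + x) (rec-suc p k) ⟩
      κ * κ ^ t * + (X ℕ.+ Y)                      ≡⟨ ℤ.*-distribˡ-+ (κ * κ ^ t) (+ X) (+ Y) ⟩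
      κ * κ ^ t * + X + κ * κ ^ t * + Y
        ≡⟨ cong₂ _+_ (rescale e α κe p (suc k) s (≡.trans (cong (λ x → p ℕ.+ suc x) (sym (ℕ.+-suc k s))) eq) (κ ^ t))
                     (rescale br Φ κbr p k (suc s) eq (κ ^ t)) ⟩
      α (pos (C p) s) * (κ ^ t * + F (suc p) (suc k)) + Φ (pos (C p) (suc s)) * (κ ^ t * + F (suc p) k)
        ≡⟨ cong₂ (λ x y → α (pos (C p) s) * x + Φ (pos (C p) (suc s)) * y)
             (scaled≡transfer t (suc p) (suc k) s eq′ (sym (ℕ.+-suc k s)))
             (scaled≡transfer t (suc p) k (suc s) eq′ refl) ⟩
      α (pos (C p) s) * transfer Cs s + Φ (pos (C p) (suc s)) * transfer Cs (suc s) ∎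
      where
      open ≡-Reasoning
      t X Y : ℕ
      t = k ℕ.+ suc s
      X = F (suc p) (suc k) ℕ.* e (a p ℕ.∸ suc k ℕ.* m)
      Y = F (suc p) k ℕ.* br (a p ℕ.∸ k ℕ.* m)
      Cs : List ℕ
      Cs = levelShifts m a (suc p) t
      eq′ : suc p ℕ.+ t ≡ L
      eq′ = ≡.trans (sym (ℕ.+-suc p t)) eq

  -- q-integers, and the passage from rook numbers to q-rook numbers

  bracket : ℕ → ℕ → ℕ
  bracket q zero    = 0
  bracket q (suc N) = 1 ℕ.+ q ℕ.* bracket q N

  bracket-one : ∀ N → bracket 1 N ≡ N
  bracket-one zero    = refl
  bracket-one (suc N) = cong suc (≡.trans (ℕ.*-identityˡ _) (bracket-one N))

  -- (q − 1)[N] = q^N − 1 with r = q − 1.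
  bracket-geometric : ∀ r N → r ℕ.* bracket (suc r) N ℕ.+ 1 ≡ suc r ℕ.^ N
  bracket-geometric r zero    = cong (ℕ._+ 1) (ℕ.*-zeroʳ r)
  bracket-geometric r (suc N) =
    ≡.trans (lemma r (bracket (suc r) N)) (cong (suc r ℕ.*_) (bracket-geometric r N))
    where
    lemma : ∀ r b → r ℕ.* (1 ℕ.+ suc r ℕ.* b) ℕ.+ 1 ≡ suc r ℕ.* (r ℕ.* b ℕ.+ 1)
    lemma = ℕSolver.solve-∀

  RookRecurrence : ℕ → ℕ → (ℕ → ℕ) → ℕ → (ℕ → ℕ → ℕ) → Set
  RookRecurrence m L a q = Recurrence m L a (q ℕ.^_) (bracket q)

  -- Rook numbers give information only at s = L - k, that is for s ≤ L; beyond that both sides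
  -- vanish.
  transfer-agree⇒ : ∀ {m α Φ} L a a′ →
    (∀ s → s ℕ.≤ L → Transfer.transfer m α Φ (levelShifts m a 0 L) s ≡ Transfer.transfer m α Φ (levelShifts m a′ 0 L) s) →
    ∀ s → Transfer.transfer m α Φ (levelShifts m a 0 L) s ≡ Transfer.transfer m α Φ (levelShifts m a′ 0 L) s
  transfer-agree⇒ {m} {α} {Φ} L a a′ eq s with s ℕ.≤? L
  ... | yes s≤L = eq s s≤L
  ... | no s≰L  = ≡.trans (zero-beyond a) (sym (zero-beyond a′))
    where
    open Transfer m α Φ
    zero-beyond : ∀ a → transfer (levelShifts m a 0 L) s ≡ 0ℤ
    zero-beyond a = transfer-vanishes (levelShifts m a 0 L) s
      (≡.subst (ℕ._< s) (sym (length-levelShifts m a 0 L)) (ℕ.≰⇒> s≰L))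

  rookNumbers⇒levelShifts : ∀ {m L a a′ F F′} →
    RookRecurrence m L a 1 F → RookRecurrence m L a′ 1 F′ →
    (∀ k → F 0 k ≡ F′ 0 k) → levelShifts m a 0 L ↭ levelShifts m a′ 0 L
  rookNumbers⇒levelShifts {m} {L} {a} {a′} {F} {F′} rec rec′ eq =
    transfer-injective m (L ℕ.* m) (levelShifts m a 0 L) (levelShifts m a′ 0 L)
      (≡.trans (length-levelShifts m a 0 L) (sym (length-levelShifts m a′ 0 L)))
      (transfer-agree⇒ L a a′ agree)
    where
    α Φ : ℕ → ℤ
    α _ = 1ℤ
    Φ n = + n - + (L ℕ.* m)
    open Transfer m α Φ
    κe : ∀ N → 1ℤ * + (1 ℕ.^ N) ≡ 1ℤ
    κe N = cong (λ x → 1ℤ * + x) (ℕ.^-zeroˡ N)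
    κbr : ∀ N → 1ℤ * + bracket 1 N ≡ + (N ℕ.+ L ℕ.* m) - + (L ℕ.* m)
    κbr N = ≡.trans (cong (λ x → 1ℤ * + x) (bracket-one N)) (lemma (+ N) (+ (L ℕ.* m)))
      where
      lemma : ∀ x y → 1ℤ * x ≡ x + y - y
      lemma = solve-∀
    agree : ∀ s → s ℕ.≤ L → transfer (levelShifts m a 0 L) s ≡ transfer (levelShifts m a′ 0 L) s
    agree s s≤L = begin
      transfer (levelShifts m a 0 L) s   ≡⟨ Solution.scaled≡transfer rec 1ℤ α Φ κe κbr L 0 (L ℕ.∸ s) s refl (ℕ.m∸n+n≡m s≤L) ⟨
      1ℤ ^ L * + F 0 (L ℕ.∸ s)           ≡⟨ cong (λ x → 1ℤ ^ L * + x) (eq (L ℕ.∸ s)) ⟩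
      1ℤ ^ L * + F′ 0 (L ℕ.∸ s)          ≡⟨ Solution.scaled≡transfer rec′ 1ℤ α Φ κe κbr L 0 (L ℕ.∸ s) s refl (ℕ.m∸n+n≡m s≤L) ⟩
      transfer (levelShifts m a′ 0 L) s  ∎
      where open ≡-Reasoning

  levelShifts⇒qRookNumbers : ∀ {m L a a′ F F′} r .{{_ : ℕ.NonZero r}} →
    RookRecurrence m L a (suc r) F → RookRecurrence m L a′ (suc r) F′ →
    levelShifts m a 0 L ↭ levelShifts m a′ 0 L → ∀ k → F 0 k ≡ F′ 0 k
  levelShifts⇒qRookNumbers {m} {L} {a} {a′} {F} {F′} r rec rec′ perm k with k ℕ.≤? L
  ... | no k≰L = ≡.trans (Recurrence.too-many rec 0 L k refl (ℕ.≰⇒> k≰L))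
                         (sym (Recurrence.too-many rec′ 0 L k refl (ℕ.≰⇒> k≰L)))
  ... | yes k≤L = ℤ.+-injective (ℤ.*-cancelˡ-≡ (κ ^ L) (+ F 0 k) (+ F′ 0 k) (begin
      κ ^ L * + F 0 k                          ≡⟨ Solution.scaled≡transfer rec κ α Φ κe κbr L 0 k (L ℕ.∸ k) refl (ℕ.m+[n∸m]≡n k≤L) ⟩
      transfer (levelShifts m a 0 L) (L ℕ.∸ k)  ≡⟨ transfer-↭ α-sym αΦ-sym perm (L ℕ.∸ k) ⟩
      transfer (levelShifts m a′ 0 L) (L ℕ.∸ k) ≡⟨ Solution.scaled≡transfer rec′ κ α Φ κe κbr L 0 k (L ℕ.∸ k) refl (ℕ.m+[n∸m]≡n k≤L) ⟨
      κ ^ L * + F′ 0 k                         ∎))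
    where
    open ≡-Reasoning
    q K : ℕ
    q = suc r
    K = L ℕ.* m
    -- With n = N + K these are κ q^N = r q^n and κ [N] = q^K (q^N - 1) = q^n - q^K. The factor r =
    -- q - 1 must be nonzero for `κ ^ L` to be cancelled.
    κ : ℤ
    κ = + r * + (q ℕ.^ K)
    α Φ : ℕ → ℤ
    α n = + r * + (q ℕ.^ n)
    Φ n = + (q ℕ.^ n) - + (q ℕ.^ K)
    open Transfer m α Φ
    instance
      κ^L≢0 : ℤ.NonZero (κ ^ L)
      κ^L≢0 = ≢-nonZero λ eq → [ (λ r≡0 → ℕ.≢-nonZero⁻¹ r (ℤ.+-injective r≡0))
                               , (λ q^K≡0 → ℕ.≢-nonZero⁻¹ q (ℕ.m^n≡0⇒m≡0 q K (ℤ.+-injective q^K≡0))) ]′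
        (ℤ.i*j≡0⇒i≡0∨j≡0 (+ r) (ℤ.i^n≡0⇒i≡0 κ L eq))
    q^+ : ∀ i j → + (q ℕ.^ (i ℕ.+ j)) ≡ + (q ℕ.^ i) * + (q ℕ.^ j)
    q^+ i j = ≡.trans (cong +_ (ℕ.^-distribˡ-+-* q i j)) (ℤ.pos-* (q ℕ.^ i) (q ℕ.^ j))
    κe : ∀ N → κ * + (q ℕ.^ N) ≡ α (N ℕ.+ K)
    κe N = ≡.trans (lemma (+ r) (+ (q ℕ.^ K)) (+ (q ℕ.^ N))) (cong (+ r *_) (sym (q^+ N K)))
      where
      lemma : ∀ x y z → x * y * z ≡ x * (z * y)
      lemma = solve-∀
    κbr : ∀ N → κ * + bracket q N ≡ Φ (N ℕ.+ K)
    κbr N = begin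
      κ * + bracket q N ≡⟨ lemma (+ r) (+ (q ℕ.^ K)) (+ bracket q N) ⟩
      (+ r * + bracket q N + 1ℤ) * + (q ℕ.^ K) - + (q ℕ.^ K)
        ≡⟨ cong (λ x → (x + 1ℤ) * + (q ℕ.^ K) - + (q ℕ.^ K)) (ℤ.pos-* r (bracket q N)) ⟨
      + (r ℕ.* bracket q N ℕ.+ 1) * + (q ℕ.^ K) - + (q ℕ.^ K)
        ≡⟨ cong (λ x → + x * + (q ℕ.^ K) - + (q ℕ.^ K)) (bracket-geometric r N) ⟩
      + (q ℕ.^ N) * + (q ℕ.^ K) - + (q ℕ.^ K)
        ≡⟨ cong (_- + (q ℕ.^ K)) (q^+ N K) ⟨
      Φ (N ℕ.+ K) ∎
      where
      lemma : ∀ x y z → x * y * z ≡ (x * z + 1ℤ) * y - y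
      lemma = solve-∀
    α-sym : ∀ x y → α (m ℕ.+ y) * α x ≡ α (m ℕ.+ x) * α y
    α-sym x y = begin
      + r * + (q ℕ.^ (m ℕ.+ y)) * α x         ≡⟨ cong (λ z → + r * z * α x) (q^+ m y) ⟩
      + r * (+ (q ℕ.^ m) * + (q ℕ.^ y)) * α x ≡⟨ lemma (+ r) (+ (q ℕ.^ m)) (+ (q ℕ.^ x)) (+ (q ℕ.^ y)) ⟩
      + r * (+ (q ℕ.^ m) * + (q ℕ.^ x)) * α y ≡⟨ cong (λ z → + r * z * α y) (q^+ m x) ⟨
      + r * + (q ℕ.^ (m ℕ.+ x)) * α y         ∎
      where
      lemma : ∀ r m x y → r * (m * y) * (r * x) ≡ r * (m * x) * (r * y)
      lemma = solve-∀
    -- Both sides equal r ((1 + q^m) q^(x + y) - q^K (q^x + q^y)), which is symmetric in x and y.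
    αΦ-sym : ∀ x y → α y * Φ x + Φ (m ℕ.+ y) * α x ≡ α x * Φ y + Φ (m ℕ.+ x) * α y
    αΦ-sym x y = begin
      α y * Φ x + Φ (m ℕ.+ y) * α x
        ≡⟨ cong (λ z → α y * Φ x + (z - + (q ℕ.^ K)) * α x) (q^+ m y) ⟩
      α y * Φ x + (+ (q ℕ.^ m) * + (q ℕ.^ y) - + (q ℕ.^ K)) * α x
        ≡⟨ lemma (+ r) (+ (q ℕ.^ m)) (+ (q ℕ.^ x)) (+ (q ℕ.^ y)) (+ (q ℕ.^ K)) ⟩
      α x * Φ y + (+ (q ℕ.^ m) * + (q ℕ.^ x) - + (q ℕ.^ K)) * α y
        ≡⟨ cong (λ z → α x * Φ y + (z - + (q ℕ.^ K)) * α y) (q^+ m x) ⟨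
      α x * Φ y + Φ (m ℕ.+ x) * α y ∎
      where
      lemma : ∀ r m x y k → r * y * (x - k) + (m * y - k) * (r * x) ≡ r * x * (y - k) + (m * x - k) * (r * y)
      lemma = solve-∀

open LevelOperators
open import Data.Nat using (_+_; _*_; _∸_; _^_; _≤_; _<_; _/_; _%_)
open import Data.Nat.DivMod
open import Data.Nat.Divisibility using (n∣m*n)
open import Data.Nat.ListAction using (sum)
open import Data.Nat.ListAction.Properties using (sum-++)
open import Data.Nat.Properties
open ℕSolver using (solve-∀)

-- Weighted counting over lists and their subsets

unique-↭ : ∀ {A : Set} {xs ys : List A} → Unique xs → Unique ys → (∀ {x} → x ∈ xs ⇔ x ∈ ys) → xs ↭ ys
unique-↭ u v eq = ∼bag⇒↭ (unique∧set⇒bag u v eq)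

⟦_⟧ : {P : Set} → Dec P → ℕ
⟦ P? ⟧ = if does P? then 1 else 0

⟦⟧-true : {P : Set} (P? : Dec P) → P → ⟦ P? ⟧ ≡ 1
⟦⟧-true P? p = cong (if_then 1 else 0) (dec-true P? p)

⟦⟧-false : {P : Set} (P? : Dec P) → ¬ P → ⟦ P? ⟧ ≡ 0
⟦⟧-false P? ¬p = cong (if_then 1 else 0) (dec-false P? ¬p)

⟦⟧-⇔ : {P Q : Set} (P? : Dec P) (Q? : Dec Q) → P ⇔ Q → ⟦ P? ⟧ ≡ ⟦ Q? ⟧
⟦⟧-⇔ P? Q? P⇔Q = cong (if_then 1 else 0) (does-⇔ P⇔Q P? Q?)

module _ {A : Set} where

  count : {P : Pred A 0ℓ} → Decidable P → List A → ℕ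
  count P? xs = length (filter P? xs)

  count-∷ : {P : Pred A 0ℓ} (P? : Decidable P) → ∀ x xs → count P? (x ∷ xs) ≡ ⟦ P? x ⟧ + count P? xs
  count-∷ P? x xs with does (P? x)
  ... | true  = refl
  ... | false = refl

  count-cong : {P Q R : Pred A 0ℓ} (P? : Decidable P) (Q? : Decidable Q) →
    (∀ {x} → R x → P x ⇔ Q x) → ∀ {xs} → All R xs → count P? xs ≡ count Q? xs
  count-cong P? Q? eq []               = refl
  count-cong P? Q? eq {x ∷ xs} (r ∷ rs) = begin
    count P? (x ∷ xs)       ≡⟨ count-∷ P? x xs ⟩
    ⟦ P? x ⟧ + count P? xs  ≡⟨ cong₂ _+_ (⟦⟧-⇔ (P? x) (Q? x) (eq r)) (count-cong P? Q? eq rs) ⟩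
    ⟦ Q? x ⟧ + count Q? xs  ≡⟨ count-∷ Q? x xs ⟨
    count Q? (x ∷ xs)       ∎
    where open ≡-Reasoning

  count-split : {P Q₁ Q₂ R : Pred A 0ℓ} (P? : Decidable P) (Q₁? : Decidable Q₁) (Q₂? : Decidable Q₂) →
    (∀ {x} → R x → ⟦ P? x ⟧ ≡ ⟦ Q₁? x ⟧ + ⟦ Q₂? x ⟧) →
    ∀ {xs} → All R xs → count P? xs ≡ count Q₁? xs + count Q₂? xs
  count-split P? Q₁? Q₂? eq [] = refl
  count-split P? Q₁? Q₂? eq {x ∷ xs} (r ∷ rs)
    rewrite count-∷ P? x xs | count-∷ Q₁? x xs | count-∷ Q₂? x xs | eq r | count-split P? Q₁? Q₂? eq rs
    = lemma ⟦ Q₁? x ⟧ ⟦ Q₂? x ⟧ (count Q₁? xs) (count Q₂? xs)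
    where
    lemma : ∀ a b c d → a + b + (c + d) ≡ a + c + (b + d)
    lemma = solve-∀

  count-none : {P : Pred A 0ℓ} (P? : Decidable P) → ∀ {xs} → All (¬_ ∘ P) xs → count P? xs ≡ 0
  count-none P? [] = refl
  count-none P? {x ∷ xs} (¬p ∷ ¬ps) =
    ≡.trans (count-∷ P? x xs) (cong₂ _+_ (⟦⟧-false (P? x) ¬p) (count-none P? ¬ps))

  sumOver : (A → ℕ) → List A → ℕ
  sumOver f xs = sum (map f xs)

  sumOver-cong : {P : Pred A 0ℓ} {f g : A → ℕ} → (∀ {x} → P x → f x ≡ g x) →
    ∀ {xs} → All P xs → sumOver f xs ≡ sumOver g xs
  sumOver-cong eq []       = refl
  sumOver-cong eq (p ∷ ps) = cong₂ _+_ (eq p) (sumOver-cong eq ps)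

  sumOver-* : ∀ c (f : A → ℕ) xs → sumOver (λ x → c * f x) xs ≡ c * sumOver f xs
  sumOver-* c f []       = sym (*-zeroʳ c)
  sumOver-* c f (x ∷ xs) = ≡.trans (cong (c * f x +_) (sumOver-* c f xs)) (sym (*-distribˡ-+ c (f x) _))

  sumOver-filter : {P : Pred A 0ℓ} (P? : Decidable P) (f : A → ℕ) → ∀ xs →
    sumOver f (filter P? xs) ≡ sumOver (λ x → ⟦ P? x ⟧ * f x) xs
  sumOver-filter P? f [] = refl
  sumOver-filter P? f (x ∷ xs) with does (P? x)
  ... | true  = cong₂ _+_ (sym (+-identityʳ (f x))) (sumOver-filter P? f xs)
  ... | false = sumOver-filter P? f xs

  -- Along a sorted list the exponents are 0, 1, 2, ...: nothing precedes the head, and the head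
  -- adds one to the rank of every later entry, whence the factor q.
  sumOver-rank : {R : Rel A 0ℓ} (R? : B.Decidable R) → Irreflexive _≡_ R → Asymmetric R →
    ∀ q {xs} → AllPairs R xs → sumOver (λ x → q ^ count (λ y → R? y x) xs) xs ≡ bracket q (length xs)
  sumOver-rank R? irr asym q [] = refl
  sumOver-rank {R} R? irr asym q {x ∷ xs} (Rx ∷ Rxs) = cong₂ _+_
    (cong (q ^_) (count-none (λ y → R? y x) (irr refl ∷ All.map asym Rx)))
    (begin
      sumOver (λ y → q ^ count (λ z → R? z y) (x ∷ xs)) xs   ≡⟨ sumOver-cong smaller Rx ⟩
      sumOver (λ y → q * q ^ count (λ z → R? z y) xs) xs     ≡⟨ sumOver-* q (λ y → q ^ count (λ z → R? z y) xs) xs ⟩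
      q * sumOver (λ y → q ^ count (λ z → R? z y) xs) xs     ≡⟨ cong (q *_) (sumOver-rank R? irr asym q Rxs) ⟩
      q * bracket q (length xs)                              ∎)
    where
    open ≡-Reasoning
    smaller : ∀ {y} → R x y → q ^ count (λ z → R? z y) (x ∷ xs) ≡ q * q ^ count (λ z → R? z y) xs
    smaller {y} Rxy = cong (q ^_) (≡.trans (count-∷ (λ z → R? z y) x xs)
      (cong (_+ count (λ z → R? z y) xs) (⟦⟧-true (R? x y) Rxy)))

  -- The chosen entries are absorbed into the weight, so that sums over subsets of concatenated or
  -- permuted lists yield to induction with varying `w`.
  subsetSum : (List A → ℕ) → List A → ℕ
  subsetSum w []       = w []
  subsetSum w (x ∷ xs) = subsetSum w xs + subsetSum (w ∘ (x ∷_)) xs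

  sumOver-subsets : ∀ (w : List A → ℕ) xs → sum (map w (subsets xs)) ≡ subsetSum w xs
  sumOver-subsets w []       = +-identityʳ (w [])
  sumOver-subsets w (x ∷ xs) = begin
    sum (map w (subsets xs ++ map (x ∷_) (subsets xs)))
      ≡⟨ cong sum (map-++ w (subsets xs) _) ⟩
    sum (map w (subsets xs) ++ map w (map (x ∷_) (subsets xs)))
      ≡⟨ sum-++ (map w (subsets xs)) _ ⟩
    sum (map w (subsets xs)) + sum (map w (map (x ∷_) (subsets xs)))
      ≡⟨ cong₂ (λ u v → u + sum v) (sumOver-subsets w xs) (sym (map-∘ (subsets xs))) ⟩
    subsetSum w xs + sum (map (w ∘ (x ∷_)) (subsets xs))
      ≡⟨ cong (subsetSum w xs +_) (sumOver-subsets (w ∘ (x ∷_)) xs) ⟩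
    subsetSum w xs + subsetSum (w ∘ (x ∷_)) xs ∎
    where open ≡-Reasoning

  subsetSum-cong : {P : Pred A 0ℓ} {w v : List A → ℕ} → (∀ {π} → All P π → w π ≡ v π) →
    ∀ {xs} → All P xs → subsetSum w xs ≡ subsetSum v xs
  subsetSum-cong eq []       = eq []
  subsetSum-cong eq (p ∷ ps) = cong₂ _+_ (subsetSum-cong eq ps) (subsetSum-cong (λ qs → eq (p ∷ qs)) ps)

  subsetSum-≗ : {w v : List A → ℕ} → (∀ π → w π ≡ v π) → ∀ xs → subsetSum w xs ≡ subsetSum v xs
  subsetSum-≗ eq []       = eq []
  subsetSum-≗ eq (x ∷ xs) = cong₂ _+_ (subsetSum-≗ eq xs) (subsetSum-≗ (eq ∘ (x ∷_)) xs)

  subsetSum-0 : ∀ (xs : List A) → subsetSum (λ _ → 0) xs ≡ 0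
  subsetSum-0 []       = refl
  subsetSum-0 (x ∷ xs) = cong₂ _+_ (subsetSum-0 xs) (subsetSum-0 xs)

  subsetSum-+ : ∀ (w v : List A → ℕ) xs →
    subsetSum (λ π → w π + v π) xs ≡ subsetSum w xs + subsetSum v xs
  subsetSum-+ w v []       = refl
  subsetSum-+ w v (x ∷ xs) = ≡.trans
    (cong₂ _+_ (subsetSum-+ w v xs) (subsetSum-+ (w ∘ (x ∷_)) (v ∘ (x ∷_)) xs))
    (lemma (subsetSum w xs) (subsetSum v xs) (subsetSum (w ∘ (x ∷_)) xs) (subsetSum (v ∘ (x ∷_)) xs))
    where
    lemma : ∀ a b c d → a + b + (c + d) ≡ a + c + (b + d)
    lemma = solve-∀

  subsetSum-* : ∀ (w : List A → ℕ) c xs → subsetSum (λ π → w π * c) xs ≡ subsetSum w xs * c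
  subsetSum-* w c []       = refl
  subsetSum-* w c (x ∷ xs) = ≡.trans (cong₂ _+_ (subsetSum-* w c xs) (subsetSum-* (w ∘ (x ∷_)) c xs))
    (sym (*-distribʳ-+ c (subsetSum w xs) _))

  subsetSum-++ : ∀ (w : List A → ℕ) xs ys →
    subsetSum w (xs ++ ys) ≡ subsetSum (λ σ → subsetSum (λ τ → w (σ ++ τ)) ys) xs
  subsetSum-++ w []       ys = refl
  subsetSum-++ w (x ∷ xs) ys = cong₂ _+_ (subsetSum-++ w xs ys) (subsetSum-++ (w ∘ (x ∷_)) xs ys)

  -- Reordering the list also reorders the entries inside each chosen subset, hence the invariance
  -- asked of `w`. This is what allows the cells to be regrouped by level.
  subsetSum-↭ : (w : List A → ℕ) → (∀ {π ρ} → π ↭ ρ → w π ≡ w ρ) →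
    ∀ {xs ys} → xs ↭ ys → subsetSum w xs ≡ subsetSum w ys
  subsetSum-↭ w inv refl         = refl
  subsetSum-↭ w inv (prep x p)   = cong₂ _+_ (subsetSum-↭ w inv p)
    (subsetSum-↭ (w ∘ (x ∷_)) (inv ∘ prep x) p)
  subsetSum-↭ w inv {x ∷ y ∷ xs} {y ∷ x ∷ ys} (swap x y p) = begin
    subsetSum w xs + subsetSum (w ∘ (y ∷_)) xs
      + (subsetSum (w ∘ (x ∷_)) xs + subsetSum (λ π → w (x ∷ y ∷ π)) xs)
      ≡⟨ cong₂ _+_ (cong₂ _+_ (subsetSum-↭ w inv p) (subsetSum-↭ (w ∘ (y ∷_)) (inv ∘ prep y) p))
           (cong₂ _+_ (subsetSum-↭ (w ∘ (x ∷_)) (inv ∘ prep x) p)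
             -- When both swapped entries are chosen they appear in opposite orders, and the
             -- invariance of `w` exchanges them.
             (≡.trans (subsetSum-≗ (λ π → inv (swap x y ↭-refl)) xs)
               (subsetSum-↭ (λ π → w (y ∷ x ∷ π)) (inv ∘ prep y ∘ prep x) p))) ⟩
    subsetSum w ys + subsetSum (w ∘ (y ∷_)) ys
      + (subsetSum (w ∘ (x ∷_)) ys + subsetSum (λ π → w (y ∷ x ∷ π)) ys)
      ≡⟨ lemma (subsetSum w ys) _ _ _ ⟩
    subsetSum w ys + subsetSum (w ∘ (x ∷_)) ys
      + (subsetSum (w ∘ (y ∷_)) ys + subsetSum (λ π → w (y ∷ x ∷ π)) ys) ∎
    where
    open ≡-Reasoning
    lemma : ∀ a b c d → a + b + (c + d) ≡ a + c + (b + d)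
    lemma = solve-∀
  subsetSum-↭ w inv (trans p p′) = ≡.trans (subsetSum-↭ w inv p) (subsetSum-↭ w inv p′)

  subsetSum-empty : {P : Pred A 0ℓ} {w : List A → ℕ} → (∀ {x} π → P x → w (x ∷ π) ≡ 0) →
    ∀ {xs} → All P xs → subsetSum w xs ≡ w []
  subsetSum-empty         w0 []                = refl
  subsetSum-empty {w = w} w0 {x ∷ xs} (p ∷ ps) = ≡.trans
    (cong₂ _+_ (subsetSum-empty w0 ps) (≡.trans (subsetSum-≗ (λ π → w0 π p) xs) (subsetSum-0 xs)))
    (+-identityʳ (w []))

  -- Meant for the cells of a single level: any two of them attack each other, so at most one
  -- carries a rook.
  subsetSum-≤1 : {P : Pred A 0ℓ} {w : List A → ℕ} →
    (∀ {x y} π → P x → P y → w (x ∷ y ∷ π) ≡ 0) →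
    ∀ {xs} → All P xs → subsetSum w xs ≡ w [] + sumOver (λ x → w (x ∷ [])) xs
  subsetSum-≤1 {w = w} w0 []                = sym (+-identityʳ (w []))
  subsetSum-≤1 {w = w} w0 {x ∷ xs} (p ∷ ps) = ≡.trans
    (cong₂ _+_ (subsetSum-≤1 w0 ps) (subsetSum-empty (λ π → w0 π p) ps))
    (lemma (w []) (sumOver (λ y → w (y ∷ [])) xs) (w (x ∷ [])))
    where
    lemma : ∀ a b c → a + b + c ≡ a + (c + b)
    lemma = solve-∀

-- Polynomials recovered from their values

eval : ℕ → Poly → ℕ
eval q []       = 0
eval q (a ∷ as) = a + q * eval q as

eval-⊕ : ∀ q f g → eval q (f ⊕ g) ≡ eval q f + eval q g
eval-⊕ q []       g        = refl
eval-⊕ q (a ∷ as) []       = sym (+-identityʳ _)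
eval-⊕ q (a ∷ as) (b ∷ bs) =
  ≡.trans (cong (λ x → a + b + q * x) (eval-⊕ q as bs)) (lemma a b q (eval q as) (eval q bs))
  where
  lemma : ∀ a b q x y → a + b + q * (x + y) ≡ a + q * x + (b + q * y)
  lemma = solve-∀

eval-q^ : ∀ q d → eval q (q^ d) ≡ q ^ d
eval-q^ q zero    = cong (1 +_) (*-zeroʳ q)
eval-q^ q (suc d) = cong (q *_) (eval-q^ q d)

digit-unique : ∀ q {a b x y} → a < q → b < q → a + q * x ≡ b + q * y → a ≡ b × x ≡ y
digit-unique q {a} {b} {x} {y} a<q b<q eq = a≡b , *-cancelˡ-≡ x y q (+-cancelˡ-≡ a _ _ (≡.trans eq (cong (_+ q * y) (sym a≡b))))
  where
  instance
    q≢0 : NonZero q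
    q≢0 = ℕ.>-nonZero (≤-trans (s≤s z≤n) a<q)
  remainder : ∀ {a} x → a < q → (a + q * x) % q ≡ a
  remainder {a} x a<q = ≡.trans (cong (λ z → (a + z) % q) (*-comm q x))
    (≡.trans ([m+kn]%n≡m%n a x q) (m<n⇒m%n≡m a<q))
  a≡b : a ≡ b
  a≡b = ≡.trans (sym (remainder x a<q)) (≡.trans (cong (_% q) eq) (remainder y b<q))

-- Coefficients below q are the base-q digits of the value.
eval-injective : ∀ q f g → All (_< q) f → All (_< q) g → eval q f ≡ eval q g → f ≈ g
eval-injective q [] [] _ _ eq d = refl
eval-injective q [] (b ∷ bs) [] (b< ∷ bs<) eq d
  -- The empty list is read as 0 + q · 0, so the other list can only contain zeros.
  with digit-unique q {x = 0} (≤-trans (s≤s z≤n) b<) b< (≡.trans (*-zeroʳ q) eq) | d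
... | 0≡b , _   | zero   = 0≡b
... | _   , eq′ | suc d′ = eval-injective q [] bs [] bs< eq′ d′
eval-injective q (a ∷ as) [] (a< ∷ as<) [] eq d
  with digit-unique q {y = 0} a< (≤-trans (s≤s z≤n) a<) (≡.trans eq (sym (*-zeroʳ q))) | d
... | a≡0 , _   | zero   = a≡0
... | _   , eq′ | suc d′ = eval-injective q as [] as< [] eq′ d′
eval-injective q (a ∷ as) (b ∷ bs) (a< ∷ as<) (b< ∷ bs<) eq d with digit-unique q a< b< eq | d
... | a≡b , _   | zero   = a≡b
... | _   , eq′ | suc d′ = eval-injective q as bs as< bs< eq′ d′

bounded : ∀ (as : List ℕ) → ∃ λ b → All (_< b) as
bounded []       = 0 , []
bounded (a ∷ as) with bounded as
... | b , as< = suc a + b , m≤m+n (suc a) b ∷ All.map (λ x< → ≤-trans x< (m≤n+m b (suc a))) as<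

-- The value used is at q = 2 + (b + c), which exceeds every coefficient of both polynomials.
eval-≈ : ∀ f g → (∀ r → eval (2 + r) f ≡ eval (2 + r) g) → f ≈ g
eval-≈ f g eq with bounded f | bounded g
... | b , f< | c , g< = eval-injective (2 + (b + c)) f g
  (All.map (λ x< → ≤-trans x< (≤-trans (m≤m+n b c) (m≤n+m (b + c) 2))) f<)
  (All.map (λ x< → ≤-trans x< (≤-trans (m≤n+m c b) (m≤n+m (b + c) 2))) g<)
  (eq (b + c))

module _ {A : Set} where

  count-++ : {P : Pred A 0ℓ} (P? : Decidable P) → ∀ xs ys → count P? (xs ++ ys) ≡ count P? xs + count P? ys
  count-++ P? xs ys = ≡.trans (cong length (filter-++ P? xs ys)) (length-++ (filter P? xs))

  count-filter : {P Q : Pred A 0ℓ} (P? : Decidable P) (Q? : Decidable Q) → ∀ xs →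
    count Q? (filter P? xs) ≡ count (λ x → P? x ×-dec Q? x) xs
  count-filter P? Q? [] = refl
  count-filter P? Q? (x ∷ xs) with P? x
  ... | no _  = count-filter P? Q? xs
  ... | yes _ with Q? x
  ...   | yes _ = cong suc (count-filter P? Q? xs)
  ...   | no _  = count-filter P? Q? xs

  AllPairs-++⁻ : {R : Rel A 0ℓ} → ∀ xs {ys} → AllPairs R (xs ++ ys) →
    AllPairs R xs × AllPairs R ys × All (λ x → All (R x) ys) xs
  AllPairs-++⁻ []       Rys        = [] , Rys , []
  AllPairs-++⁻ (x ∷ xs) (Rx ∷ Rxs) with AllPairs-++⁻ xs Rxs | All.++⁻ xs Rx
  ... | Rxs′ , Rys , Rxys | Rx₁ , Rx₂ = Rx₁ ∷ Rxs′ , Rys , Rx₂ ∷ Rxys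

-- Cells, levels and the cells left free by a rook

module _ {n : ℕ} (rows : Fin n → List ℕ) where

  -- Common form of `cells B`, whose columns come from `upTo`, and of `sortedCells`, whose columns
  -- come from `downFrom`.
  columnwise : List (Fin n × ℕ)
  columnwise = concatMap (λ i → map (i ,_) (rows i)) (allFin n)

  ∈-columnwise : ∀ {i j} → (i , j) ∈ columnwise ⇔ j ∈ rows i
  ∈-columnwise {i} {j} = mk⇔
    (λ c∈ → let k , _ , c∈k = ∈-∃ (∈-concatMap⁻ _ {xs = allFin n} c∈) in inColumn k c∈k)
    (λ j∈ → ∈-concatMap⁺ _ (Any.map (λ { refl → ∈-map⁺ (i ,_) j∈ }) (∈-allFin i)))
    where
    ∈-∃ : ∀ {P : Pred (Fin n) 0ℓ} {xs} → Any.Any P xs → ∃ λ k → k ∈ xs × P k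
    ∈-∃ (here p)  = _ , here refl , p
    ∈-∃ (there p) = let k , k∈ , pk = ∈-∃ p in k , there k∈ , pk
    inColumn : ∀ k → (i , j) ∈ map (k ,_) (rows k) → j ∈ rows i
    inColumn k c∈ with _ , j∈ , refl ← ∈-map⁻ (k ,_) c∈ = j∈

  columnwise-AllPairs : {R : Rel (Fin n × ℕ) 0ℓ} →
    (∀ {i i′ j j′} → i F.< i′ → R (i , j) (i′ , j′)) →
    (∀ i → AllPairs (λ j j′ → R (i , j) (i , j′)) (rows i)) → AllPairs R columnwise
  columnwise-AllPairs across within = AllPairs.concat⁺
    (All.map⁺ (All.tabulate⁺ (λ i → AllPairs.map⁺ (within i))))
    (AllPairs.map⁺ (AllPairs.tabulate⁺-< (λ i<i′ →
      All.map⁺ (All.universal (λ _ → All.map⁺ (All.universal (λ _ → across i<i′) _)) _))))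

module Levels (m : ℕ) .{{m≢0 : NonZero m}} (B : FerrersBoard) where

  private
    ℓ : Cell B → ℕ
    ℓ = level m B

  ℓ-mono : ∀ {c r : Cell B} → proj₂ c ≤ proj₂ r → ℓ c ≤ ℓ r
  ℓ-mono = /-monoˡ-≤ m

  -- Columns left to right, each column top to bottom: the cells of its level that a
  -- rook leaves as inversions are the available ones preceding it in this order.
  infix 4 _≺_ _≺?_
  _≺_ : Cell B → Cell B → Set
  c ≺ r = proj₁ c F.< proj₁ r ⊎ (proj₁ c ≡ proj₁ r × proj₂ r < proj₂ c)

  _≺?_ : B.Decidable _≺_
  c ≺? r = (proj₁ c F.<? proj₁ r) ⊎-dec ((proj₁ c F.≟ proj₁ r) ×-dec (proj₂ r <? proj₂ c))

  ≺-irrefl : Irreflexive _≡_ _≺_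
  ≺-irrefl refl (inj₁ i<i)       = F.<-irrefl refl i<i
  ≺-irrefl refl (inj₂ (_ , j<j)) = <-irrefl refl j<j

  ≺-asym : Asymmetric _≺_
  ≺-asym (inj₁ i<k)          (inj₁ k<i)       = F.<-asym i<k k<i
  ≺-asym (inj₁ i<i)          (inj₂ (refl , _)) = F.<-irrefl refl i<i
  ≺-asym (inj₂ (refl , _))   (inj₁ i<i)       = F.<-irrefl refl i<i
  ≺-asym (inj₂ (_ , j<l))    (inj₂ (_ , l<j)) = <-asym j<l l<j

  -- The condition that a single rook imposes on an inversion. It turns `Inversion` into an `All`
  -- over the placement, so rooks in higher, equal and lower levels can be treated separately.
  Free : Cell B → Cell B → Set
  Free c r = c ≢ r × ¬ AboveInColumn m B c r × ¬ LeftInLevel m B c r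

  inversion⇔free : ∀ {π c} → Inversion m B π c ⇔ All (Free c) π
  inversion⇔free {π} = mk⇔
    (λ (c∉ , ¬above , ¬left) → All.zip (All.¬Any⇒All¬ π c∉ , All.zip (All.¬Any⇒All¬ π ¬above , All.¬Any⇒All¬ π ¬left)))
    (λ free → All.All¬⇒¬Any (All.map proj₁ free)
            , All.All¬⇒¬Any (All.map (proj₁ ∘ proj₂) free)
            , All.All¬⇒¬Any (All.map (proj₂ ∘ proj₂) free))

  -- Because of this, a rook added to level p leaves the inversions in the levels above p unchanged.
  free-lower : ∀ {c r} → ℓ r < ℓ c → Free c r
  free-lower {c} {r} r<c =
      (λ { refl → <-irrefl refl r<c })
    , (λ (_ , c<r) → <⇒≱ r<c (ℓ-mono {c} {r} (<⇒≤ c<r)))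
    , (λ (r≡c , _) → <⇒≢ r<c r≡c)

  -- A rook in a higher level lies above every cell of its own column in this level and shares its
  -- level with none of them.
  free-upper : ∀ {c r} → ℓ c < ℓ r → Free c r ⇔ proj₁ r ≢ proj₁ c
  free-upper {c} {r} c<r = mk⇔
    (λ (_ , ¬above , _) i≡ → ¬above (i≡ , ≰⇒> (λ r≤c → <⇒≱ c<r (ℓ-mono {r} {c} r≤c))))
    (λ i≢ → (λ { refl → i≢ refl }) , (λ (i≡ , _) → i≢ i≡) , (λ (r≡c , _) → <⇒≢ c<r (sym r≡c)))

  free-level : ∀ {c r} → ℓ c ≡ ℓ r → Free c r ⇔ c ≺ r
  free-level {c@(i , j)} {r@(k , l)} c≡r = mk⇔ to from
    where
    to : Free c r → c ≺ r
    to (c≢r , ¬above , ¬left) with F.<-cmp i k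
    ... | tri< i<k _ _ = inj₁ i<k
    ... | tri> _ _ k<i = contradiction (sym c≡r , k<i) ¬left
    ... | tri≈ _ refl _ with <-cmp j l
    ...   | tri< j<l _ _  = contradiction (refl , j<l) ¬above
    ...   | tri≈ _ refl _ = contradiction refl c≢r
    ...   | tri> _ _ l<j  = inj₂ (refl , l<j)
    from : c ≺ r → Free c r
    from c≺r = (λ c≡r → ≺-irrefl c≡r c≺r)
      , (λ (i≡ , j<l) → ≺-asym c≺r (inj₂ (i≡ , j<l)))
      , (λ (_ , k<i) → ≺-asym c≺r (inj₁ k<i))

  sortedCells : List (Cell B)
  sortedCells = columnwise (downFrom ∘ height B)

  sortedCells-sorted : AllPairs _≺_ sortedCells
  sortedCells-sorted = columnwise-AllPairs (downFrom ∘ height B) inj₁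
    (λ i → AllPairs.applyDownFrom⁺₁ _ (height B i) (λ j<i _ → inj₂ (refl , j<i)))

  sorted⇒unique : ∀ {xs} → AllPairs _≺_ xs → Unique xs
  sorted⇒unique = AllPairs.map (λ c≺r c≡r → ≺-irrefl c≡r c≺r)

  ∈-sortedCells : ∀ {i j} → (i , j) ∈ sortedCells ⇔ j < height B i
  ∈-sortedCells = mk⇔
    (∈-downFrom⁻ ∘ Equivalence.to (∈-columnwise (downFrom ∘ height B)))
    (Equivalence.from (∈-columnwise (downFrom ∘ height B)) ∘ ∈-downFrom⁺)

  cells-unique : Unique (cells B)
  cells-unique = columnwise-AllPairs (upTo ∘ height B) (λ { i<i refl → F.<-irrefl refl i<i })
    (λ i → AllPairs.applyUpTo⁺₁ _ (height B i) (λ { j<j _ refl → <-irrefl refl j<j }))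

  cells↭sortedCells : cells B ↭ sortedCells
  cells↭sortedCells = unique-↭ cells-unique (sorted⇒unique sortedCells-sorted) (mk⇔
    (Equivalence.from ∈-sortedCells ∘ ∈-upTo⁻ ∘ Equivalence.to (∈-columnwise (upTo ∘ height B)))
    (Equivalence.from (∈-columnwise (upTo ∘ height B)) ∘ ∈-upTo⁺ ∘ Equivalence.to ∈-sortedCells))

  levelsFrom : ℕ → List (Cell B)
  levelsFrom p = filter (λ c → p ≤? ℓ c) sortedCells

  levelCells : ℕ → List (Cell B)
  levelCells p = filter (λ c → ℓ c ≟ p) sortedCells

  levelSize : ℕ → ℕ
  levelSize p = length (levelCells p)

  levelsFrom-split : ∀ p → levelsFrom p ↭ levelsFrom (suc p) ++ levelCells p
  levelsFrom-split p = unique-↭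
    (Unique.filter⁺ (λ c → p ≤? ℓ c) unique)
    (Unique.++⁺ (Unique.filter⁺ (λ c → suc p ≤? ℓ c) unique) (Unique.filter⁺ (λ c → ℓ c ≟ p) unique)
      (λ (c∈ , c∈′) → <⇒≢ (proj₂ (∈-filter⁻ (λ c → suc p ≤? ℓ c) {xs = sortedCells} c∈))
                           (sym (proj₂ (∈-filter⁻ (λ c → ℓ c ≟ p) {xs = sortedCells} c∈′)))))
    (mk⇔ to from)
    where
    unique : Unique sortedCells
    unique = sorted⇒unique sortedCells-sorted
    to : ∀ {c} → c ∈ levelsFrom p → c ∈ levelsFrom (suc p) ++ levelCells p
    to {c} c∈ with ∈-filter⁻ (λ c → p ≤? ℓ c) {xs = sortedCells} c∈
    ... | c∈B , p≤c with m≤n⇒m<n∨m≡n p≤c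
    ...   | inj₁ p<c = ∈-++⁺ˡ (∈-filter⁺ (λ c → suc p ≤? ℓ c) c∈B p<c)
    ...   | inj₂ p≡c = ∈-++⁺ʳ (levelsFrom (suc p)) (∈-filter⁺ (λ c → ℓ c ≟ p) c∈B (sym p≡c))
    from : ∀ {c} → c ∈ levelsFrom (suc p) ++ levelCells p → c ∈ levelsFrom p
    from c∈ with ∈-++⁻ (levelsFrom (suc p)) c∈
    ... | inj₁ c∈₁ = let c∈B , p<c = ∈-filter⁻ (λ c → suc p ≤? ℓ c) {xs = sortedCells} c∈₁
                     in ∈-filter⁺ (λ c → p ≤? ℓ c) c∈B (<⇒≤ p<c)
    ... | inj₂ c∈₂ = let c∈B , c≡p = ∈-filter⁻ (λ c → ℓ c ≟ p) {xs = sortedCells} c∈₂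
                     in ∈-filter⁺ (λ c → p ≤? ℓ c) c∈B (≤-reflexive (sym c≡p))

  -- `Cell B` does not bound the row, so membership in the board is recorded; it is what makes the
  -- rook's column reach through all of level p.
  HigherThan : ℕ → Cell B → Set
  HigherThan p c = p < ℓ c × proj₂ c < height B (proj₁ c)

  levelsFrom-higher : ∀ p → All (HigherThan p) (levelsFrom (suc p))
  levelsFrom-higher p = All.tabulate λ {c} c∈ →
    let c∈B , p<c = ∈-filter⁻ (λ c → suc p ≤? ℓ c) {xs = sortedCells} c∈
    in p<c , Equivalence.to ∈-sortedCells c∈B

  levelCells-level : ∀ p → All (λ c → ℓ c ≡ p) (levelCells p)
  levelCells-level p = All.all-filter (λ c → ℓ c ≟ p) sortedCells

  column-full : ∀ p i → suc p * m ≤ height B i → count (λ c → i F.≟ proj₁ c) (levelCells p) ≡ m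
  column-full p i full = ≡.trans (↭-length same) (≡.trans (length-map cell (upTo m)) (length-upTo m))
    where
    cell : ℕ → Cell B
    cell j = i , p * m + j
    cell-level : ∀ {j} → j < m → ℓ (cell j) ≡ p
    cell-level {j} j<m = begin
      (p * m + j) / m      ≡⟨ +-distrib-/-∣ˡ j (n∣m*n p) ⟩
      p * m / m + j / m    ≡⟨ cong₂ _+_ (m*n/n≡m p m) (m<n⇒m/n≡0 j<m) ⟩
      p + 0                ≡⟨ +-identityʳ p ⟩
      p                    ∎
      where open ≡-Reasoning
    row : ∀ j → j / m ≡ p → j ≡ p * m + j % m
    row j eq = ≡.trans (m≡m%n+[m/n]*n j m)
      (≡.trans (+-comm (j % m) _) (cong (λ x → x * m + j % m) eq))
    to : ∀ {c} → c ∈ filter (λ c → i F.≟ proj₁ c) (levelCells p) → c ∈ map cell (upTo m)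
    to {c} c∈ with ∈-filter⁻ (λ c → i F.≟ proj₁ c) {xs = levelCells p} c∈
    ... | c∈p , refl = ≡.subst (_∈ map cell (upTo m))
      (cong (i ,_) (sym (row (proj₂ c) (proj₂ (∈-filter⁻ (λ c → ℓ c ≟ p) {xs = sortedCells} c∈p)))))
      (∈-map⁺ cell (∈-upTo⁺ (m%n<n (proj₂ c) m)))
    from : ∀ {c} → c ∈ map cell (upTo m) → c ∈ filter (λ c → i F.≟ proj₁ c) (levelCells p)
    from c∈ with ∈-map⁻ cell c∈
    ... | j , j∈ , refl = ∈-filter⁺ (λ c → i F.≟ proj₁ c)
      (∈-filter⁺ (λ c → ℓ c ≟ p)
        (Equivalence.from ∈-sortedCells
          (<-≤-trans (+-monoʳ-< (p * m) (∈-upTo⁻ j∈)) (≤-trans (≤-reflexive (+-comm (p * m) m)) full)))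
        (cell-level (∈-upTo⁻ j∈)))
      refl
    same : filter (λ c → i F.≟ proj₁ c) (levelCells p) ↭ map cell (upTo m)
    same = unique-↭
      (Unique.filter⁺ (λ c → i F.≟ proj₁ c) (Unique.filter⁺ (λ c → ℓ c ≟ p) (sorted⇒unique sortedCells-sorted)))
      (Unique.map⁺ (λ eq → +-cancelˡ-≡ (p * m) _ _ (cong proj₂ eq)) (Unique.upTo⁺ m))
      (mk⇔ to from)

  Available : List (Cell B) → Cell B → Set
  Available σ c = All (λ r → proj₁ r ≢ proj₁ c) σ

  available? : ∀ σ → Decidable (Available σ)
  available? σ c = All.all? (λ r → ¬? (proj₁ r F.≟ proj₁ c)) σ

  -- Each rook removes the m cells of its column, and non-attacking rooks remove disjoint sets. The
  -- additive form also gives `length σ * m ≤ levelSize p`, which rules out too many rooks above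
  -- level p.
  available-count : ∀ p σ → All (HigherThan p) σ → AllPairs (NonAttacking m B) σ →
    count (available? σ) (levelCells p) + length σ * m ≡ levelSize p
  available-count p [] _ _ = ≡.trans (+-identityʳ _)
    (cong length (filter-all (available? []) (All.universal (λ _ → []) (levelCells p))))
  available-count p (r ∷ σ) ((p<r , r<h) ∷ hs) (na ∷ nas) = begin
    count (available? (r ∷ σ)) (levelCells p) + (m + length σ * m)
      ≡⟨ +-assoc (count (available? (r ∷ σ)) (levelCells p)) m (length σ * m) ⟨
    count (available? (r ∷ σ)) (levelCells p) + m + length σ * m
      ≡⟨ cong (λ x → count (available? (r ∷ σ)) (levelCells p) + x + length σ * m) (column-full p (proj₁ r) full) ⟨
    count (available? (r ∷ σ)) (levelCells p) + count (λ c → proj₁ r F.≟ proj₁ c) (levelCells p) + length σ * m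
      ≡⟨ cong (_+ length σ * m) (count-split (available? σ) (available? (r ∷ σ)) (λ c → proj₁ r F.≟ proj₁ c)
           split (levelCells-level p)) ⟨
    count (available? σ) (levelCells p) + length σ * m
      ≡⟨ available-count p σ hs nas ⟩
    levelSize p ∎
    where
    open ≡-Reasoning
    full : suc p * m ≤ height B (proj₁ r)
    full = ≤-trans (*-monoˡ-≤ m p<r) (≤-trans (m/n*n≤m (proj₂ r) m) (<⇒≤ r<h))
    split : ∀ {c} → ℓ c ≡ p →
      ⟦ available? σ c ⟧ ≡ ⟦ available? (r ∷ σ) c ⟧ + ⟦ proj₁ r F.≟ proj₁ c ⟧
    split {c} _ = by-column (proj₁ r F.≟ proj₁ c)
      where
      by-column : Dec (proj₁ r ≡ proj₁ c) →
        ⟦ available? σ c ⟧ ≡ ⟦ available? (r ∷ σ) c ⟧ + ⟦ proj₁ r F.≟ proj₁ c ⟧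
      by-column (yes r≡c) = ≡.trans
        (⟦⟧-true (available? σ c) (All.map (λ (r≢s , _) s≡c → r≢s (≡.trans r≡c (sym s≡c))) na))
        (sym (cong₂ _+_ (⟦⟧-false (available? (r ∷ σ) c) (λ { (r≢c ∷ _) → r≢c r≡c }))
                        (⟦⟧-true (proj₁ r F.≟ proj₁ c) r≡c)))
      by-column (no r≢c) = ≡.trans
        (⟦⟧-⇔ (available? σ c) (available? (r ∷ σ) c) (mk⇔ (r≢c ∷_) All.tail))
        (sym (≡.trans (cong (⟦ available? (r ∷ σ) c ⟧ +_) (⟦⟧-false (proj₁ r F.≟ proj₁ c) r≢c)) (+-identityʳ _)))

-- Weights of placements and their recurrence

module Weights (m : ℕ) .{{m≢0 : NonZero m}} (B : FerrersBoard) (q : ℕ) where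

  open Levels m B

  private
    ℓ : Cell B → ℕ
    ℓ = level m B

  -- `X` is the region in which inversions are counted, so that the levels from p upward can be
  -- weighed on their own. Lists that are not placements weigh 0, which lets the sums run over all
  -- subsets.
  weight : List (Cell B) → ℕ → List (Cell B) → ℕ
  weight X k π = ⟦ isPlacement? m B k π ⟧ * q ^ count (inversion? m B π) X

  weight-placement : ∀ X k π → IsPlacement m B k π → weight X k π ≡ q ^ count (inversion? m B π) X
  weight-placement X k π ok =
    ≡.trans (cong (_* q ^ count (inversion? m B π) X) (⟦⟧-true (isPlacement? m B k π) ok)) (*-identityˡ _)

  weight-none : ∀ X k π → ¬ IsPlacement m B k π → weight X k π ≡ 0
  weight-none X k π ¬ok =
    cong (_* q ^ count (inversion? m B π) X) (⟦⟧-false (isPlacement? m B k π) ¬ok)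

  count-inversions : ∀ {π ρ} {R : Pred (Cell B) 0ℓ} →
    (∀ {c} → R c → All (Free c) π ⇔ All (Free c) ρ) →
    ∀ {X} → All R X → count (inversion? m B π) X ≡ count (inversion? m B ρ) X
  count-inversions {π} {ρ} eq = count-cong (inversion? m B π) (inversion? m B ρ)
    (λ r → ⇔-trans inversion⇔free (⇔-trans (eq r) (⇔-sym inversion⇔free)))

  weight-↭ : ∀ {X Y k π ρ} → X ↭ Y → π ↭ ρ → weight X k π ≡ weight Y k ρ
  weight-↭ {X} {Y} {k} {π} {ρ} X↭Y π↭ρ = cong₂ (λ x y → x * q ^ y)
    (⟦⟧-⇔ (isPlacement? m B k π) (isPlacement? m B k ρ) (mk⇔ (placement π↭ρ) (placement (↭-sym π↭ρ))))
    (≡.trans (count-inversions (λ _ → mk⇔ (All-resp-↭ π↭ρ) (All-resp-↭ (↭-sym π↭ρ))) (All.universal (λ _ → tt) X))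
      (↭-length (filter-↭ (inversion? m B ρ) X↭Y)))
    where
    nonAttacking-sym : ∀ {c d} → NonAttacking m B c d → NonAttacking m B d c
    nonAttacking-sym (i≢ , ℓ≢) = ≢-sym i≢ , ≢-sym ℓ≢
    placement : ∀ {π ρ} → π ↭ ρ → IsPlacement m B k π → IsPlacement m B k ρ
    placement π↭ρ (len , na) = ≡.trans (sym (↭-length π↭ρ)) len
      , Permutationₛ.AllPairs-resp-↭ (≡.setoid (Cell B)) nonAttacking-sym (≡.resp₂ (NonAttacking m B)) (↭⇒↭ₛ π↭ρ) na

  weightSum : ℕ → ℕ → ℕ
  weightSum p k = subsetSum (weight (levelsFrom p) k) (levelsFrom p)

  module _ (p : ℕ) {σ : List (Cell B)} (hs : All (HigherThan p) σ) where

    private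
      i : ℕ
      i = count (inversion? m B σ) (levelsFrom (suc p))

      av : List (Cell B)
      av = filter (available? σ) (levelCells p)

    count-levelsFrom : {P : Pred (Cell B) 0ℓ} (P? : Decidable P) →
      count P? (levelsFrom p) ≡ count P? (levelsFrom (suc p)) + count P? (levelCells p)
    count-levelsFrom P? = ≡.trans (↭-length (filter-↭ P? (levelsFrom-split p)))
      (count-++ P? (levelsFrom (suc p)) (levelCells p))

    available⇔free : ∀ {c} → ℓ c ≡ p → All (Free c) σ ⇔ Available σ c
    available⇔free {c} refl = mk⇔
      (λ free → All.zipWith (λ ((c<r , _) , f) → Equivalence.to (free-upper {c} c<r) f) (hs , free))
      (λ av → All.zipWith (λ ((c<r , _) , a) → Equivalence.from (free-upper {c} c<r) a) (hs , av))

    inversions-∅ : count (inversion? m B σ) (levelsFrom p) ≡ i + length av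
    inversions-∅ = ≡.trans (count-levelsFrom (inversion? m B σ))
      (cong (i +_) (count-cong (inversion? m B σ) (available? σ)
        (λ c≡p → ⇔-trans inversion⇔free (available⇔free c≡p)) (levelCells-level p)))

    -- The new rook does not affect higher levels by `free-lower`; in level p it keeps exactly those
    -- available cells that precede it.
    inversions-rook : ∀ {x} → ℓ x ≡ p →
      count (inversion? m B (σ ++ x ∷ [])) (levelsFrom p) ≡ i + count (_≺? x) av
    inversions-rook {x} x≡p = ≡.trans (count-levelsFrom (inversion? m B (σ ++ x ∷ [])))
      (cong₂ _+_
        (count-inversions (λ {c} (p<c , _) → mk⇔ (All.++⁻ˡ σ)
            (λ free → All.++⁺ free (free-lower {c} (≡.subst (_< ℓ c) (sym x≡p) p<c) ∷ [])))
          (levelsFrom-higher p))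
        (≡.trans
          (count-cong (inversion? m B (σ ++ x ∷ [])) (λ c → available? σ c ×-dec (c ≺? x)) below (levelCells-level p))
          (sym (count-filter (available? σ) (_≺? x) (levelCells p)))))
      where
      below : ∀ {c} → ℓ c ≡ p → Inversion m B (σ ++ x ∷ []) c ⇔ (Available σ c × c ≺ x)
      below {c} c≡p = mk⇔
        (λ inv → let free = Equivalence.to inversion⇔free inv
                 in Equivalence.to (available⇔free c≡p) (All.++⁻ˡ σ free)
                  , Equivalence.to same (All.head (All.++⁻ʳ σ free)))
        (λ (a , c≺x) → Equivalence.from inversion⇔free
          (All.++⁺ (Equivalence.from (available⇔free c≡p) a) (Equivalence.from same c≺x ∷ [])))
        where
        same : Free c x ⇔ c ≺ x
        same = free-level (≡.trans c≡p (sym x≡p))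

    module _ (na : AllPairs (NonAttacking m B) σ) where

      length-available : length av ≡ levelSize p ∸ length σ * m
      length-available = ≡.trans (sym (m+n∸n≡m (length av) (length σ * m)))
        (cong (_∸ length σ * m) (available-count p σ hs na))

      weight-∅ : ∀ k → weight (levelsFrom p) k σ ≡ weight (levelsFrom (suc p)) k σ * q ^ (levelSize p ∸ k * m)
      weight-∅ k with length σ ≟ k
      ... | no len≢ = ≡.trans (weight-none (levelsFrom p) k σ (len≢ ∘ proj₁))
        (sym (cong (_* q ^ (levelSize p ∸ k * m)) (weight-none (levelsFrom (suc p)) k σ (len≢ ∘ proj₁))))
      ... | yes refl = begin
        weight (levelsFrom p) k σ                               ≡⟨ weight-placement (levelsFrom p) k σ (refl , na) ⟩
        q ^ count (inversion? m B σ) (levelsFrom p)             ≡⟨ cong (q ^_) inversions-∅ ⟩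
        q ^ (i + length av)                                     ≡⟨ ^-distribˡ-+-* q i (length av) ⟩
        q ^ i * q ^ length av                                   ≡⟨ cong₂ (λ x y → x * q ^ y) (sym (weight-placement (levelsFrom (suc p)) k σ (refl , na))) length-available ⟩
        weight (levelsFrom (suc p)) k σ * q ^ (levelSize p ∸ k * m) ∎
        where open ≡-Reasoning

      placement⇔available : ∀ {x} → ℓ x ≡ p → IsPlacement m B (suc (length σ)) (σ ++ x ∷ []) ⇔ Available σ x
      placement⇔available {x} x≡p = mk⇔
        (λ (_ , na′) → All.map (λ { ((i≢ , _) ∷ []) → i≢ }) (proj₂ (proj₂ (AllPairs-++⁻ σ na′))))
        (λ av → ≡.trans (length-++ σ) (+-comm (length σ) 1)
              , AllPairs.++⁺ na ([] ∷ []) (All.zipWith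
                  (λ ((p<r , _) , i≢) → (i≢ , λ r≡x → <⇒≢ p<r (sym (≡.trans r≡x x≡p))) ∷ []) (hs , av)))

      -- Only available cells extend `σ` to a placement, and a rook in such a cell leaves as many
      -- inversions in level p as its rank among them. Summing over the ranks gives the q-integer.
      weight-rook : ∀ k → sumOver (λ x → weight (levelsFrom p) (suc k) (σ ++ x ∷ [])) (levelCells p)
                            ≡ weight (levelsFrom (suc p)) k σ * bracket q (levelSize p ∸ k * m)
      weight-rook k with length σ ≟ k
      ... | no len≢ = ≡.trans
        (sumOver-cong (λ {x} _ → weight-none (levelsFrom p) (suc k) (σ ++ x ∷ []) (λ (len , _) →
            len≢ (suc-injective (≡.trans (sym (≡.trans (length-++ σ) (+-comm (length σ) 1))) len))))
          (levelCells-level p))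
        (≡.trans (sumOver-* 0 (λ _ → 0) (levelCells p))
          (sym (cong (_* bracket q (levelSize p ∸ k * m)) (weight-none (levelsFrom (suc p)) k σ (len≢ ∘ proj₁)))))
      ... | yes refl = begin
        sumOver (λ x → weight (levelsFrom p) (suc k) (σ ++ x ∷ [])) (levelCells p)
          ≡⟨ sumOver-cong (λ {x} x≡p → cong₂ _*_
               (⟦⟧-⇔ (isPlacement? m B (suc k) (σ ++ x ∷ [])) (available? σ x) (placement⇔available x≡p))
               (≡.trans (cong (q ^_) (inversions-rook x≡p)) (^-distribˡ-+-* q i _))) (levelCells-level p) ⟩
        sumOver (λ x → ⟦ available? σ x ⟧ * (q ^ i * q ^ count (_≺? x) av)) (levelCells p)
          ≡⟨ sumOver-filter (available? σ) (λ x → q ^ i * q ^ count (_≺? x) av) (levelCells p) ⟨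
        sumOver (λ x → q ^ i * q ^ count (_≺? x) av) av
          ≡⟨ sumOver-* (q ^ i) (λ x → q ^ count (_≺? x) av) av ⟩
        q ^ i * sumOver (λ x → q ^ count (_≺? x) av) av
          ≡⟨ cong (q ^ i *_) (sumOver-rank _≺?_ ≺-irrefl ≺-asym q
               (AllPairs.filter⁺ (available? σ) (AllPairs.filter⁺ (λ c → ℓ c ≟ p) sortedCells-sorted))) ⟩
        q ^ i * bracket q (length av)
          ≡⟨ cong₂ (λ x y → x * bracket q y) (sym (weight-placement (levelsFrom (suc p)) k σ (refl , na))) length-available ⟩
        weight (levelsFrom (suc p)) k σ * bracket q (levelSize p ∸ k * m) ∎
        where open ≡-Reasoning

    clash : ∀ X k {x y} τ → ℓ x ≡ p → ℓ y ≡ p → weight X k (σ ++ x ∷ y ∷ τ) ≡ 0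
    clash X k τ x≡p y≡p = weight-none X k _ λ (_ , na) → case proj₁ (proj₂ (AllPairs-++⁻ σ na)) of λ
      { (((_ , x≢y) ∷ _) ∷ _) → x≢y (≡.trans x≡p (sym y≡p)) }

    attacking : ¬ AllPairs (NonAttacking m B) σ → ∀ X k τ → weight X k (σ ++ τ) ≡ 0
    attacking ¬na X k τ = weight-none X k _ (λ (_ , na) → ¬na (proj₁ (AllPairs-++⁻ σ na)))

    extend-attacking : ¬ AllPairs (NonAttacking m B) σ → ∀ {v} → v ≡ 0 → ∀ k →
      subsetSum (λ τ → weight (levelsFrom p) k (σ ++ τ)) (levelCells p) ≡ v
    extend-attacking ¬na v≡0 k = ≡.trans (subsetSum-≗ (attacking ¬na (levelsFrom p) k) (levelCells p))
      (≡.trans (subsetSum-0 (levelCells p)) (sym v≡0))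

    extend-zero : subsetSum (λ τ → weight (levelsFrom p) 0 (σ ++ τ)) (levelCells p)
                    ≡ weight (levelsFrom (suc p)) 0 σ * q ^ levelSize p
    extend-zero = [ extend , (λ ¬na → extend-attacking ¬na
        (cong (_* q ^ levelSize p) (weight-none (levelsFrom (suc p)) 0 σ (¬na ∘ proj₂))) 0) ]′
      (toSum (allPairs? (nonAttacking? m B) σ))
      where
      open ≡-Reasoning
      length-++-∷ : ∀ x τ → length (σ ++ x ∷ τ) ≡ suc (length σ + length τ)
      length-++-∷ x τ = ≡.trans (length-++ σ) (+-suc (length σ) (length τ))
      extend : AllPairs (NonAttacking m B) σ → _
      extend na = begin
        subsetSum (λ τ → weight (levelsFrom p) 0 (σ ++ τ)) (levelCells p)
          ≡⟨ subsetSum-empty (λ {x} τ _ → weight-none (levelsFrom p) 0 (σ ++ x ∷ τ) (λ (len , _) → 1+n≢0 (≡.trans (sym (length-++-∷ x τ)) len)))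
               (levelCells-level p) ⟩
        weight (levelsFrom p) 0 (σ ++ [])
          ≡⟨ cong (weight (levelsFrom p) 0) (++-identityʳ σ) ⟩
        weight (levelsFrom p) 0 σ
          ≡⟨ weight-∅ na 0 ⟩
        weight (levelsFrom (suc p)) 0 σ * q ^ levelSize p ∎

    extend-suc : ∀ k → subsetSum (λ τ → weight (levelsFrom p) (suc k) (σ ++ τ)) (levelCells p)
                   ≡ weight (levelsFrom (suc p)) (suc k) σ * q ^ (levelSize p ∸ suc k * m)
                     + weight (levelsFrom (suc p)) k σ * bracket q (levelSize p ∸ k * m)
    extend-suc k = [ extend , (λ ¬na → extend-attacking ¬na
        (cong₂ (λ x y → x * q ^ (levelSize p ∸ suc k * m) + y * bracket q (levelSize p ∸ k * m))
          (weight-none (levelsFrom (suc p)) (suc k) σ (¬na ∘ proj₂)) (weight-none (levelsFrom (suc p)) k σ (¬na ∘ proj₂))) (suc k)) ]′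
      (toSum (allPairs? (nonAttacking? m B) σ))
      where
      extend : AllPairs (NonAttacking m B) σ → _
      extend na = ≡.trans (subsetSum-≤1 (clash (levelsFrom p) (suc k)) (levelCells-level p))
        (cong₂ _+_ (≡.trans (cong (weight (levelsFrom p) (suc k)) (++-identityʳ σ)) (weight-∅ na (suc k)))
                   (weight-rook na k))

  weightSum-extend : ∀ p k →
    weightSum p k ≡ subsetSum (λ σ → subsetSum (λ τ → weight (levelsFrom p) k (σ ++ τ)) (levelCells p)) (levelsFrom (suc p))
  weightSum-extend p k = ≡.trans
    (subsetSum-↭ (weight (levelsFrom p) k) (weight-↭ {X = levelsFrom p} ↭-refl) (levelsFrom-split p))
    (subsetSum-++ (weight (levelsFrom p) k) (levelsFrom (suc p)) (levelCells p))

  -- The columns of k non-attacking rooks above level p would contain k m cells of that level, more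
  -- than it has.
  weightSum-vanish : ∀ p k → levelSize p < k * m → weightSum (suc p) k ≡ 0
  weightSum-vanish p k a<km = ≡.trans
    (subsetSum-cong (λ {σ} hs → weight-none (levelsFrom (suc p)) k σ (λ { (refl , na) → <⇒≱ a<km
      (≤-trans (m≤n+m (length σ * m) _) (≤-reflexive (available-count p σ hs na))) })) (levelsFrom-higher p))
    (subsetSum-0 (levelsFrom (suc p)))

  levelsFrom-top : ∀ {L} → All (λ c → ℓ c < L) sortedCells → levelsFrom L ≡ []
  levelsFrom-top {L} low = filter-none (λ c → L ≤? ℓ c) (All.map <⇒≱ low)

  recurrence : ∀ {L} → All (λ c → ℓ c < L) sortedCells → RookRecurrence m L levelSize q weightSum
  recurrence {L} low = record
    { top-zero = cong (λ X → subsetSum (weight X 0) X) (levelsFrom-top low)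
    ; top-suc  = λ k → cong (λ X → subsetSum (weight X (suc k)) X) (levelsFrom-top low)
    ; rec-zero = λ p → ≡.trans (weightSum-extend p 0)
        (≡.trans (subsetSum-cong (extend-zero p) (levelsFrom-higher p))
          (subsetSum-* (weight (levelsFrom (suc p)) 0) _ (levelsFrom (suc p))))
    ; rec-suc  = λ p k → ≡.trans (weightSum-extend p (suc k))
        (≡.trans (subsetSum-cong (λ hs → extend-suc p hs k) (levelsFrom-higher p))
          (≡.trans (subsetSum-+ _ _ (levelsFrom (suc p)))
            (cong₂ _+_ (subsetSum-* (weight (levelsFrom (suc p)) (suc k)) _ (levelsFrom (suc p)))
                       (subsetSum-* (weight (levelsFrom (suc p)) k) _ (levelsFrom (suc p))))))
    ; vanish   = weightSum-vanish
    }

  placements-weightSum : ∀ k → sumOver (λ π → q ^ inv m B π) (placements m B k) ≡ weightSum 0 k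
  placements-weightSum k = begin
    sumOver (λ π → q ^ inv m B π) (placements m B k)
      ≡⟨ sumOver-filter (isPlacement? m B k) (λ π → q ^ inv m B π) (subsets (cells B)) ⟩
    sumOver (weight (cells B) k) (subsets (cells B))
      ≡⟨ sumOver-subsets (weight (cells B) k) (cells B) ⟩
    subsetSum (weight (cells B) k) (cells B)
      ≡⟨ subsetSum-↭ (weight (cells B) k) (weight-↭ {X = cells B} ↭-refl) cells↭sortedCells ⟩
    subsetSum (weight (cells B) k) sortedCells
      ≡⟨ subsetSum-≗ (λ π → weight-↭ {π = π} cells↭sortedCells ↭-refl) sortedCells ⟩
    subsetSum (weight sortedCells k) sortedCells
      ≡⟨ cong (λ X → subsetSum (weight X k) X) (filter-all (λ c → 0 ≤? ℓ c) (All.universal (λ _ → z≤n) sortedCells)) ⟨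
    weightSum 0 k ∎
    where open ≡-Reasoning

-- Rook numbers and q-rook numbers as weight sums

module _ (m : ℕ) .{{_ : NonZero m}} (B : FerrersBoard) where

  eval-qRookNumber : ∀ q k → eval q (qRookNumber m B k) ≡ Weights.weightSum m B q 0 k
  eval-qRookNumber q k = ≡.trans (go (placements m B k)) (Weights.placements-weightSum m B q k)
    where
    go : ∀ πs → eval q (foldr (λ π f → (q^ inv m B π) ⊕ f) [] πs) ≡ sumOver (λ π → q ^ inv m B π) πs
    go []       = refl
    go (π ∷ πs) = ≡.trans (eval-⊕ q (q^ inv m B π) _) (cong₂ _+_ (eval-q^ q (inv m B π)) (go πs))

  rookNumber-weightSum : ∀ k → rookNumber m B k ≡ Weights.weightSum m B 1 0 k
  rookNumber-weightSum k = ≡.trans (go (placements m B k)) (Weights.placements-weightSum m B 1 k)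
    where
    go : ∀ πs → length πs ≡ sumOver (λ π → 1 ^ inv m B π) πs
    go []       = refl
    go (π ∷ πs) = cong₂ _+_ (sym (^-zeroˡ (inv m B π))) (go πs)

  levels-bounded : ∃ λ L → All (λ c → level m B c < L) (Levels.sortedCells m B)
  levels-bounded = let L , low = bounded (map (level m B) (Levels.sortedCells m B)) in L , All.map⁻ low

theorem16 : (m : ℕ) .{{_ : NonZero m}} (B B′ : FerrersBoard) → RookEquivalent m B B′ → ∀ k → qRookNumber m B k ≈ qRookNumber m B′ k
theorem16 m B B′ equiv k = eval-≈ (qRookNumber m B k) (qRookNumber m B′ k) λ r → begin
  eval (2 + r) (qRookNumber m B k)   ≡⟨ eval-qRookNumber m B (2 + r) k ⟩
  -- `suc r` is q - 1 for q = 2 + r, hence nonzero.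
  Weights.weightSum m B (2 + r) 0 k  ≡⟨ levelShifts⇒qRookNumbers (suc r) (rec (2 + r)) (rec′ (2 + r)) sameShifts k ⟩
  Weights.weightSum m B′ (2 + r) 0 k ≡⟨ eval-qRookNumber m B′ (2 + r) k ⟨
  eval (2 + r) (qRookNumber m B′ k)  ∎
  where
  open ≡-Reasoning
  L₁ L₂ L : ℕ
  L₁ = proj₁ (levels-bounded m B)
  L₂ = proj₁ (levels-bounded m B′)
  -- A common number of levels that bounds both boards; the surplus levels are empty.
  L  = L₁ + L₂
  rec : ∀ q → RookRecurrence m L (Levels.levelSize m B) q (Weights.weightSum m B q)
  rec q = Weights.recurrence m B q
    (All.map (λ l< → ≤-trans l< (m≤m+n L₁ L₂)) (proj₂ (levels-bounded m B)))
  rec′ : ∀ q → RookRecurrence m L (Levels.levelSize m B′) q (Weights.weightSum m B′ q)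
  rec′ q = Weights.recurrence m B′ q
    (All.map (λ l< → ≤-trans l< (m≤n+m L₂ L₁)) (proj₂ (levels-bounded m B′)))
  sameShifts : levelShifts m (Levels.levelSize m B) 0 L ↭ levelShifts m (Levels.levelSize m B′) 0 L
  sameShifts = rookNumbers⇒levelShifts (rec 1) (rec′ 1) λ k →
    ≡.trans (sym (rookNumber-weightSum m B k)) (≡.trans (equiv k) (rookNumber-weightSum m B′ k))
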